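{- Let $x\in\{0,1\}^{\mathbb{Z}^2}$ be strongly recurrent. Then exactly one of the following alternatives holds. (i) $x$ is doubly periodic, in which case $p_x^{*\mathrm{ab}}(k)\leq[\mathbb{Z}^2:\operatorname{Per}(x)]$ for all positive integers $k$; (ii) $x$ is not doubly periodic, in which case $p_x^{*\mathrm{ab}}(k)=k+1$ for all positive integers $k$.
   Context: For a finite set $S\subset\mathbb{Z}^2$ and $t\in\mathbb{Z}^2$, the $S$-factor of $x$ at $t$ is $x[t+S]=(x(t+s))_{s\in S}$. Two $S$-factors are Abelian equivalent if each letter occurs the same number of times in both. Let $p_x^{\mathrm{ab}}(S)$ be the number of Abelian equivalence classes of $S$-factors of $x$ (over all $t\in\mathbb{Z}^2$), and $p_x^{*\mathrm{ab}}(k)=\sup\{p_x^{\mathrm{ab}}(S): S\subset\mathbb{Z}^2,\ \#S=k\}$. $\operatorname{Per}(x)=\{p\in\mathbb{Z}^2: x(t+p)=x(t)\ \forall t\in\mathbb{Z}^2\}$, a subgroup of $\mathbb{Z}^2$; $x$ is doubly periodic if $\operatorname{Per}(x)$ contains two linearly independent vectors. $[\mathbb{Z}^2:H]$ is the index of a subgroup $H$. $\mathbb{P}^1(\mathbb{R})$ is the set of lines through $0$ in $\mathbb{R}^2$; $\operatorname{dir}(q)=\mathbb{R}q$ for $q\neq0$; identifying $\mathbb{P}^1(\mathbb{R})$ with $\mathbb{R}/\pi\mathbb{Z}$ by angle, $d_\pi([\theta],[\phi])=\min_{m\in\mathbb{Z}}|\theta-\phi-m\pi|$. Let $\Sigma_N=[-N,N]^2\cap\mathbb{Z}^2$.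 $x$ is strongly recurrent if there is $\delta>0$ such that for every $N\geq1$ there are nonzero $u_N,v_N\in\mathbb{Z}^2$ with $x(z+u_N)=x(z)=x(z+v_N)$ for all $z\in\Sigma_N$ and $d_\pi(\operatorname{dir}(u_N),\operatorname{dir}(v_N))\geq\delta$. -}

module Defs where

import Algebra.Definitions.RawSemiring
open import Data.Fin.Base using (Fin)
open import Data.Fin.Properties using (_≟_)
open import Data.Integer.Base as ℤ using (ℤ; +_; 0ℤ)
import Data.Integer.Properties as ℤ
open import Data.List.Base using (List; filter; length; map)
open import Data.List.Relation.Unary.Unique.Propositional using (Unique)
open import Data.Nat.Base as ℕ using (ℕ; zero; suc; _!)
import Data.Nat.Properties as ℕ
open import Data.Product.Base using (Σ-syntax; ∃-syntax; _×_; _,_; zip)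
open import Data.Rational.Base as ℚ using (ℚ; 0ℚ; 1ℚ)
import Data.Rational.Properties as ℚ
open import Function.Base using (_on_)
open import Function.Bundles using (Inverse)
open import Level using (0ℓ)
open import Relation.Binary.Bundles using (Setoid)
open import Relation.Binary.PropositionalEquality
  using (_≡_; _≢_; refl; sym; trans; cong; cong₂; setoid)
open import Relation.Unary using (Pred; _∈_)

open Algebra.Definitions.RawSemiring ℚ.+-*-rawSemiring using (_^_)

------------------------------------------------------------------------
-- Real numbers

-- A real is represented by a Cauchy sequence of rationals.  Arithmetic,
-- sine and cosine act on the underlying sequences term by term, and `_≃_`,
-- `_≤_`, `_<_` are equality and order of the limits.

Seq : Set
Seq = ℕ → ℚ

Cauchy : Pred Seq 0ℓ
Cauchy a = ∀ ε → 0ℚ ℚ.< ε → ∃[ K ] ∀ m n → K ℕ.≤ m → K ℕ.≤ n →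
           ℚ.∣ a m ℚ.- a n ∣ ℚ.≤ ε

record Real : Set where
  constructor mkReal
  field
    seq    : Seq
    cauchy : Cauchy seq

open Real public

infix  4 _≃_ _≤_ _<_
infixl 6 _-_
infixl 7 _*_

_≃_ : Seq → Seq → Set
a ≃ b = ∀ ε → 0ℚ ℚ.< ε → ∃[ K ] ∀ n → K ℕ.≤ n → ℚ.∣ a n ℚ.- b n ∣ ℚ.≤ ε

_≤_ : Seq → Seq → Set
a ≤ b = ∀ ε → 0ℚ ℚ.< ε → ∃[ K ] ∀ n → K ℕ.≤ n → a n ℚ.≤ b n ℚ.+ ε

_<_ : Seq → Seq → Set
a < b = ∃[ ε ] (0ℚ ℚ.< ε) × ∃[ K ] ∀ n → K ℕ.≤ n → a n ℚ.+ ε ℚ.≤ b n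

fromℤ : ℤ → Seq
fromℤ i _ = i ℚ./ 1

_-_ : Seq → Seq → Seq
(a - b) n = a n ℚ.- b n

_*_ : Seq → Seq → Seq
(a * b) n = a n ℚ.* b n

abs : Seq → Seq
abs a n = ℚ.∣ a n ∣

sumBelow : ℕ → (ℕ → ℚ) → ℚ
sumBelow zero    f = 0ℚ
sumBelow (suc n) f = sumBelow n f ℚ.+ f n

invFactorial : ℕ → ℚ
invFactorial n = ((+ 1) ℚ./ (n !)) {{n ℕ.!≢0}}

-- Since the Taylor series converge uniformly on bounded sets, evaluating the
-- n-th partial sum at the n-th approximation gives a sequence with the
-- correct limit.

sin : Seq → Seq
sin a n = sumBelow n λ j →
  (ℚ.- 1ℚ) ^ j ℚ.* a n ^ suc (2 ℕ.* j) ℚ.* invFactorial (suc (2 ℕ.* j))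

cos : Seq → Seq
cos a n = sumBelow n λ j →
  (ℚ.- 1ℚ) ^ j ℚ.* a n ^ (2 ℕ.* j) ℚ.* invFactorial (2 ℕ.* j)

-- π is the only zero of the sine in [3, 4].

IsPi : Pred Real 0ℓ
IsPi π = (fromℤ (+ 3) ≤ seq π) × (seq π ≤ fromℤ (+ 4)) ×
         (sin (seq π) ≃ fromℤ 0ℤ)

------------------------------------------------------------------------
-- The lattice ℤ² and directions of its vectors

ℤ² : Set
ℤ² = ℤ × ℤ

infixl 6 _⊕_ _⊖_
infixl 7 _·_

_⊕_ : ℤ² → ℤ² → ℤ²
_⊕_ = zip ℤ._+_ ℤ._+_

_⊖_ : ℤ² → ℤ² → ℤ²
_⊖_ = zip ℤ._-_ ℤ._-_

_·_ : ℤ → ℤ² → ℤ²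
c · (p₁ , p₂) = c ℤ.* p₁ , c ℤ.* p₂

𝟎 : ℤ²
𝟎 = 0ℤ , 0ℤ

LinearlyIndependent : ℤ² → ℤ² → Set
LinearlyIndependent p q =
  ∀ a b → a · p ⊕ b · q ≡ 𝟎 → (a ≡ 0ℤ) × (b ≡ 0ℤ)

-- For q ≢ 𝟎: q lies on ℝ(cos θ, sin θ), that is, [θ] ∈ ℝ/πℤ corresponds to
-- the line dir(q).

DirHasAngle : ℤ² → Real → Set
DirHasAngle (q₁ , q₂) θ = Σ[ r ∈ Real ]
  (fromℤ q₁ ≃ seq r * cos (seq θ)) × (fromℤ q₂ ≃ seq r * sin (seq θ))

-- d = min over m ∈ ℤ of |θ - φ - mπ|.

Isdπ : (π θ φ d : Real) → Set
Isdπ π θ φ d = (∃[ m ] seq d ≃ term m) × (∀ m → seq d ≤ term m)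
  where
  term : ℤ → Seq
  term m = abs (seq θ - seq φ - fromℤ m * seq π)

-- d = d_π(dir(u), dir(v)), for u, v ≢ 𝟎.

IsDirDistance : (u v : ℤ²) → Real → Set
IsDirDistance u v d = Σ[ π ∈ Real ] Σ[ θ ∈ Real ] Σ[ φ ∈ Real ]
  IsPi π × DirHasAngle u θ × DirHasAngle v φ × Isdπ π θ φ d

------------------------------------------------------------------------
-- Cardinalities and suprema, as single-valued relations

-- The setoid Q has exactly n equivalence classes.

HasClasses : Setoid 0ℓ 0ℓ → ℕ → Set
HasClasses Q n = Inverse (setoid (Fin n)) Q

IsSup : Pred ℕ 0ℓ → Pred ℕ 0ℓ
IsSup P m = (∀ n → n ∈ P → n ℕ.≤ m) × (∀ b → (∀ n → n ∈ P → n ℕ.≤ b) → m ℕ.≤ b)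

------------------------------------------------------------------------
-- Configurations and Abelian complexity

Config : Set
Config = ℤ² → Fin 2

-- A duplicate-free list enumerates a finite set S; the factor lists the
-- values x(t + s) in the order of that enumeration.

factor : Config → ℤ² → List ℤ² → List (Fin 2)
factor x t S = map (λ s → x (t ⊕ s)) S

occurrences : Fin 2 → List (Fin 2) → ℕ
occurrences a w = length (filter (_≟ a) w)

AbelianEquivalent : List (Fin 2) → List (Fin 2) → Set
AbelianEquivalent w w′ = ∀ a → occurrences a w ≡ occurrences a w′

-- Positions t, t′ are identified when x[t+S] and x[t′+S] are Abelian
-- equivalent, so the classes are those of S-factors of x.

abelianClasses : Config → List ℤ² → Setoid 0ℓ 0ℓ
abelianClasses x S = record
  { Carrier       = ℤ²
  ; _≈_           = AbelianEquivalent on (λ t → factor x t S)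
  ; isEquivalence = record
    { refl  = λ _ → refl
    ; sym   = λ e a → sym (e a)
    ; trans = λ e f a → trans (e a) (f a)
    }
  }

-- p_x^ab(S) = n

AbelianComplexity : Config → List ℤ² → ℕ → Set
AbelianComplexity x S = HasClasses (abelianClasses x S)

-- p_x^{*ab}(k) = m

MaximalPatternAbelianComplexity : Config → ℕ → ℕ → Set
MaximalPatternAbelianComplexity x k = IsSup λ n →
  Σ[ S ∈ List ℤ² ] Unique S × (length S ≡ k) × AbelianComplexity x S n

------------------------------------------------------------------------
-- Periods

Per : Config → Pred ℤ² 0ℓ
Per x p = ∀ t → x (t ⊕ p) ≡ x t

DoublyPeriodic : Pred Config 0ℓ
DoublyPeriodic x = ∃[ p ] ∃[ q ] p ∈ Per x × q ∈ Per x × LinearlyIndependent p q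

private
  ⊕-⊖-self : ∀ s t → s ⊕ (t ⊖ t) ≡ s
  ⊕-⊖-self (s₁ , s₂) (t₁ , t₂) = cong₂ _,_ (lem s₁ t₁) (lem s₂ t₂)
    where
    lem : ∀ a b → a ℤ.+ (b ℤ.- b) ≡ a
    lem a b = trans (cong (λ c → a ℤ.+ c) (ℤ.+-inverseʳ b)) (ℤ.+-identityʳ a)

  -- s + (a - b) + (b - c) = s + (a - c)
  ⊕-⊖-chain : ∀ s a b c → s ⊕ (a ⊖ b) ⊕ (b ⊖ c) ≡ s ⊕ (a ⊖ c)
  ⊕-⊖-chain (s₁ , s₂) (a₁ , a₂) (b₁ , b₂) (c₁ , c₂) =
    cong₂ _,_ (lem s₁ a₁ b₁ c₁) (lem s₂ a₂ b₂ c₂)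
    where
    lem : ∀ s a b c → s ℤ.+ (a ℤ.- b) ℤ.+ (b ℤ.- c) ≡ s ℤ.+ (a ℤ.- c)
    lem s a b c = trans (ℤ.+-assoc s (a ℤ.- b) (b ℤ.- c))
                        (cong (λ d → s ℤ.+ d) (ℤ.+-minus-telescope a b c))

-- ℤ² / Per(x)

cosets : Config → Setoid 0ℓ 0ℓ
cosets x = record
  { Carrier       = ℤ²
  ; _≈_           = λ a b → a ⊖ b ∈ Per x
  ; isEquivalence = record
    { refl  = λ {a} s → cong x (⊕-⊖-self s a)
    ; sym   = λ {a} {b} e s → trans (sym (e (s ⊕ (b ⊖ a))))
                (cong x (trans (⊕-⊖-chain s b a b) (⊕-⊖-self s b)))
    ; trans = λ {a} {b} {c} e f s → trans (cong x (sym (⊕-⊖-chain s a b c)))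
                (trans (f (s ⊕ (a ⊖ b))) (e s))
    }
  }

-- [ℤ² : Per(x)] = n

PeriodIndex : Config → ℕ → Set
PeriodIndex x = HasClasses (cosets x)

------------------------------------------------------------------------
-- Strong recurrence

_∈Σ_ : ℤ² → ℕ → Set
(z₁ , z₂) ∈Σ N = (ℤ.- (+ N) ℤ.≤ z₁ × z₁ ℤ.≤ + N) × (ℤ.- (+ N) ℤ.≤ z₂ × z₂ ℤ.≤ + N)

StronglyRecurrent : Pred Config 0ℓ
StronglyRecurrent x = Σ[ δ ∈ Real ] (fromℤ 0ℤ < seq δ) ×
  (∀ N → 1 ℕ.≤ N → ∃[ u ] ∃[ v ] u ≢ 𝟎 × v ≢ 𝟎 ×
    (∀ z → z ∈Σ N → (x (z ⊕ u) ≡ x z) × (x z ≡ x (z ⊕ v))) ×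
    Σ[ d ∈ Real ] IsDirDistance u v d × (seq δ ≤ seq d))

{-# OPTIONS --safe #-}
module Submission where

-- Suppose that x is not doubly periodic.  The lower bound on the angle makes u_N and v_N linearly
-- independent, so one of them is not a period; hence every finite set F admits a non-period u with
-- x(z + u) = x(z) on F.  Fix p with x(p) ≠ x(p + u) for each such u.  By a Ramsey argument
-- (largeness, "for every F some member recurs on F", is partition regular) one may assume that an
-- earlier displacement v either is neutral, x(p + v) = x(p) and x(p + u + v) = x(p + u), for all
-- later pairs, or changes the value at p for all of them, or at p + u for all of them.  Each of the
-- three cases yields a staircase: k translates S and points t₀, …, t_k such that the value of
-- x(t_i + s) jumps at the i-th element s of S, so all k + 1 letter counts occur.  If neutral, S
-- consists of the partial sums u₁ + … + u_j, otherwise of the displacements v themselves.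

-- The obstacle is the angle bound: π, sine and cosine are given by rational partial sums, so a
-- large part of the proof builds the addition theorem of the sine with uniform error bounds.
-- Parallel vectors at angles θ and φ have sin(θ - φ) = 0. If m attains the minimum in the distance,
-- y = θ - φ - mπ is again a zero of the sine, and comparing m with m + 1 and m - 1 gives |y| ≤ π/2
-- ≤ 2. An explicit lower bound for the sine up to 9/4 then forces y = 0, against a distance of at
-- least δ > 0. The Ramsey argument is finitary: a large family is shrunk finitely often. A chain of
-- neutral sums either reaches length k or meets a sum v that fails to be neutral, in one fixed way,
-- for a large subfamily. Such a v lengthens one of two further staircases, one for each way of
-- failing, so the search ends after at most 2k - 1 failures.

open import Defs hiding (_≃_; _≤_; _<_; _-_; _*_)
import Algebra.Definitions.RawSemiring
open import Axiom.ExcludedMiddle using (ExcludedMiddle)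
open import Data.Empty using (⊥; ⊥-elim)
open import Data.Fin.Base using (Fin; zero; suc; toℕ; fromℕ<)
import Data.Fin.Properties as Fin
open import Data.Integer.Base as ℤ using (ℤ; +_; 0ℤ; 1ℤ)
import Data.Integer.DivMod as ℤ
import Data.Integer.Properties as ℤ
import Data.Integer.Tactic.RingSolver as ℤ
open import Data.List.Base using (List; []; _∷_; _++_; length; map; lookup; upTo; cartesianProduct; deduplicate)
open import Data.List.Membership.Propositional using () renaming (_∈_ to _∈ₗ_)
open import Data.List.Membership.Propositional.Properties
  using (∈-map⁺; ∈-++⁺ˡ; ∈-++⁺ʳ; ∈-upTo⁺; ∈-cartesianProduct⁺)
open import Data.List.Properties using (filter-accept; filter-reject; length-filter; length-map)
open import Data.List.Relation.Unary.All as All using (All; []; _∷_)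
open import Data.List.Relation.Unary.AllPairs using ([]; _∷_)
open import Data.List.Relation.Unary.Any as Any using (Any; here; there)
import Data.List.Relation.Unary.Any.Properties as Any
open import Data.List.Relation.Unary.Unique.Propositional using (Unique)
import Data.List.Relation.Unary.Unique.DecSetoid.Properties as UniqueDec
import Data.List.Relation.Unary.Unique.Setoid as UniqueSetoid
open import Data.Nat.Base as ℕ using (ℕ; zero; suc; z≤n; s≤s; _∸_; _!) renaming (_≤_ to _≤ℕ_; _<_ to _<ℕ_)
import Data.Nat.Properties as ℕ
open import Data.Product.Base using (∃-syntax; Σ-syntax; _×_; _,_; proj₁; proj₂)
open import Data.Rational.Base
open import Data.Rational.Properties
import Data.Rational.Unnormalised.Base as ℚᵘ
import Data.Rational.Unnormalised.Properties as ℚᵘ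
open import Data.Sum.Base using (_⊎_; inj₁; inj₂)
import Defs as D
open import Function.Bundles using (Inverse)
open import Level using (0ℓ)
open import Relation.Binary.Bundles using (Setoid; DecSetoid)
open import Relation.Binary.PropositionalEquality hiding (setoid)
open import Relation.Nullary.Decidable using (dec⇒maybe; from-yes; from-no; Dec; yes; no)
open import Relation.Nullary.Negation.Core using (¬_)
open import Relation.Unary using (Pred; _∈_; _⊆_; _∩_; ∁)
open import Tactic.RingSolver using (solve-∀)
open import Tactic.RingSolver.Core.AlmostCommutativeRing using (AlmostCommutativeRing; fromCommutativeRing)

open Algebra.Definitions.RawSemiring +-*-rawSemiring using (_^_)

-- The lattice

⊕-assoc : ∀ s t u → s ⊕ t ⊕ u ≡ s ⊕ (t ⊕ u)
⊕-assoc (s₁ , s₂) (t₁ , t₂) (u₁ , u₂) = cong₂ _,_ (ℤ.+-assoc s₁ t₁ u₁) (ℤ.+-assoc s₂ t₂ u₂)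

⊕-comm : ∀ s t → s ⊕ t ≡ t ⊕ s
⊕-comm (s₁ , s₂) (t₁ , t₂) = cong₂ _,_ (ℤ.+-comm s₁ t₁) (ℤ.+-comm s₂ t₂)

⊕-identityʳ : ∀ s → s ⊕ 𝟎 ≡ s
⊕-identityʳ (s₁ , s₂) = cong₂ _,_ (ℤ.+-identityʳ s₁) (ℤ.+-identityʳ s₂)

det : ℤ² → ℤ² → ℤ
det (p₁ , p₂) (q₁ , q₂) = p₁ ℤ.* q₂ ℤ.- p₂ ℤ.* q₁

-- Cramer's rule, used twice: if the determinant vanishes these combinations are linear relations,
-- and if `p` and `q` are periods they yield periods along the axes.
eliminate₁ : ∀ p q → proj₂ q · p ⊕ (ℤ.- proj₂ p) · q ≡ (det p q , 0ℤ)
eliminate₁ (p₁ , p₂) (q₁ , q₂) = cong₂ _,_ (lem₁ p₁ p₂ q₁ q₂) (lem₂ p₂ q₂)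
  where
  lem₁ : ∀ p₁ p₂ q₁ q₂ → q₂ ℤ.* p₁ ℤ.+ (ℤ.- p₂) ℤ.* q₁ ≡ p₁ ℤ.* q₂ ℤ.- p₂ ℤ.* q₁
  lem₁ = ℤ.solve-∀
  lem₂ : ∀ p₂ q₂ → q₂ ℤ.* p₂ ℤ.+ (ℤ.- p₂) ℤ.* q₂ ≡ 0ℤ
  lem₂ = ℤ.solve-∀

eliminate₂ : ∀ p q → (ℤ.- proj₁ q) · p ⊕ proj₁ p · q ≡ (0ℤ , det p q)
eliminate₂ (p₁ , p₂) (q₁ , q₂) = cong₂ _,_ (lem₁ p₁ q₁) (lem₂ p₁ p₂ q₁ q₂)
  where
  lem₁ : ∀ p₁ q₁ → (ℤ.- q₁) ℤ.* p₁ ℤ.+ p₁ ℤ.* q₁ ≡ 0ℤ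
  lem₁ = ℤ.solve-∀
  lem₂ : ∀ p₁ p₂ q₁ q₂ → (ℤ.- q₁) ℤ.* p₂ ℤ.+ p₁ ℤ.* q₂ ≡ p₁ ℤ.* q₂ ℤ.- p₂ ℤ.* q₁
  lem₂ = ℤ.solve-∀

LinearlyIndependent⇒det≢0 : ∀ p q → LinearlyIndependent p q → det p q ≢ 0ℤ
LinearlyIndependent⇒det≢0 p q indep det≡0
  with indep (proj₂ q) (ℤ.- proj₂ p) (trans (eliminate₁ p q) (cong (_, 0ℤ) det≡0))
     | indep (ℤ.- proj₁ q) (proj₁ p) (trans (eliminate₂ p q) (cong (0ℤ ,_) det≡0))
-- Both coordinates of `q` vanish, so 0 and 1 are the coefficients of a nontrivial relation.
... | q₂≡0 , _ | -q₁≡0 , _ = 1ℤ≢0ℤ (proj₂ (indep 0ℤ 1ℤ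
  (cong₂ _,_ (absorb (proj₁ p) (ℤ.neg-injective -q₁≡0)) (absorb (proj₂ p) q₂≡0))))
  where
  absorb : ∀ i {j} → j ≡ 0ℤ → 0ℤ ℤ.* i ℤ.+ 1ℤ ℤ.* j ≡ 0ℤ
  absorb i refl = refl
  1ℤ≢0ℤ : 1ℤ ≢ 0ℤ
  1ℤ≢0ℤ ()

det≢0⇒LinearlyIndependent : ∀ p q → det p q ≢ 0ℤ → LinearlyIndependent p q
det≢0⇒LinearlyIndependent p@(p₁ , p₂) q@(q₁ , q₂) det≢0 a b e =
    vanish a (trans (lem₁ p₁ p₂ q₁ q₂ a b) (cong₂ (λ c d → c ℤ.* q₂ ℤ.- d ℤ.* q₁) e₁ e₂))
  , vanish b (trans (lem₂ p₁ p₂ q₁ q₂ a b) (trans (cong₂ (λ c d → d ℤ.* p₁ ℤ.- c ℤ.* p₂) e₁ e₂) refl))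
  where
  e₁ = cong proj₁ e
  e₂ = cong proj₂ e
  lem₁ : ∀ p₁ p₂ q₁ q₂ a b → a ℤ.* (p₁ ℤ.* q₂ ℤ.- p₂ ℤ.* q₁) ≡
         (a ℤ.* p₁ ℤ.+ b ℤ.* q₁) ℤ.* q₂ ℤ.- (a ℤ.* p₂ ℤ.+ b ℤ.* q₂) ℤ.* q₁
  lem₁ = ℤ.solve-∀
  lem₂ : ∀ p₁ p₂ q₁ q₂ a b → b ℤ.* (p₁ ℤ.* q₂ ℤ.- p₂ ℤ.* q₁) ≡
         (a ℤ.* p₂ ℤ.+ b ℤ.* q₂) ℤ.* p₁ ℤ.- (a ℤ.* p₁ ℤ.+ b ℤ.* q₁) ℤ.* p₂
  lem₂ = ℤ.solve-∀
  vanish : ∀ c → c ℤ.* det p q ≡ 0ℤ → c ≡ 0ℤ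
  vanish c h with ℤ.i*j≡0⇒i≡0∨j≡0 c h
  ... | inj₁ c≡0 = c≡0
  ... | inj₂ d≡0 = ⊥-elim (det≢0 d≡0)

i≤∣i∣ : ∀ i → i ℤ.≤ + ℤ.∣ i ∣
i≤∣i∣ (+ n)      = ℤ.≤-refl
i≤∣i∣ ℤ.-[1+ n ] = ℤ.-≤+

-∣i∣≤i : ∀ i → ℤ.- (+ ℤ.∣ i ∣) ℤ.≤ i
-∣i∣≤i i = subst (ℤ.- (+ ℤ.∣ i ∣) ℤ.≤_) (ℤ.neg-involutive i)
  (ℤ.neg-mono-≤ (subst (λ n → ℤ.- i ℤ.≤ + n) (ℤ.∣-i∣≡∣i∣ i) (i≤∣i∣ (ℤ.- i))))

∈Σ-intro : ∀ {z N} → ℤ.∣ proj₁ z ∣ ≤ℕ N → ℤ.∣ proj₂ z ∣ ≤ℕ N → z ∈Σ N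
∈Σ-intro {z₁ , z₂} h₁ h₂ = interval z₁ h₁ , interval z₂ h₂
  where
  interval : ∀ {N} i → ℤ.∣ i ∣ ≤ℕ N → ℤ.- (+ N) ℤ.≤ i × i ℤ.≤ + N
  interval i h = ℤ.≤-trans (ℤ.neg-mono-≤ (ℤ.+≤+ h)) (-∣i∣≤i i) , ℤ.≤-trans (i≤∣i∣ i) (ℤ.+≤+ h)

finite⇒bounded : ∀ F → ∃[ N ] ∀ {z} → z ∈ₗ F → ℤ.∣ proj₁ z ∣ ≤ℕ N × ℤ.∣ proj₂ z ∣ ≤ℕ N
finite⇒bounded [] = 0 , λ ()
finite⇒bounded ((z₁ , z₂) ∷ F) with finite⇒bounded F
... | N , bound = ℤ.∣ z₁ ∣ ℕ.+ ℤ.∣ z₂ ∣ ℕ.+ N , λ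
  { (here refl) → ℕ.≤-trans (ℕ.m≤m+n ℤ.∣ z₁ ∣ ℤ.∣ z₂ ∣) (ℕ.m≤m+n _ N)
                , ℕ.≤-trans (ℕ.m≤n+m ℤ.∣ z₂ ∣ ℤ.∣ z₁ ∣) (ℕ.m≤m+n _ N)
  ; (there z∈F) → ℕ.≤-trans (proj₁ (bound z∈F)) (ℕ.m≤n+m N _)
                , ℕ.≤-trans (proj₂ (bound z∈F)) (ℕ.m≤n+m N _)
  }

-- Ordered field arithmetic

ℚ-ring : AlmostCommutativeRing 0ℓ 0ℓ
ℚ-ring = fromCommutativeRing +-*-commutativeRing λ p → dec⇒maybe (0ℚ ≟ p)

-- Inequalities between polynomials are reduced to ring identities: the difference of the two sides
-- is exhibited as a sum of products of nonnegative terms.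

0≤-difference : ∀ {p q} → p ≤ q → 0ℚ ≤ q - p
0≤-difference {p} {q} p≤q = subst (_≤ q - p) (+-inverseʳ p) (+-monoˡ-≤ (- p) p≤q)

0≤⇒≤ : ∀ {p q r} → 0ℚ ≤ r → r ≡ q - p → p ≤ q
0≤⇒≤ {p} {q} 0≤r refl = subst₂ _≤_ (+-identityʳ p) (lem p q) (+-monoʳ-≤ p 0≤r)
  where
  lem : ∀ p q → p + (q - p) ≡ q
  lem = solve-∀ ℚ-ring

0≤-+ : ∀ {p q} → 0ℚ ≤ p → 0ℚ ≤ q → 0ℚ ≤ p + q
0≤-+ 0≤p 0≤q = +-mono-≤ 0≤p 0≤q

0≤-* : ∀ {p q} → 0ℚ ≤ p → 0ℚ ≤ q → 0ℚ ≤ p * q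
0≤-* {p} {q} 0≤p 0≤q = subst (_≤ p * q) (*-zeroʳ p) (*-monoˡ-≤-nonNeg p {{nonNegative 0≤p}} 0≤q)

*-mono-≤-nonNeg : ∀ {p q r s} → 0ℚ ≤ p → 0ℚ ≤ s → p ≤ q → r ≤ s → p * r ≤ q * s
*-mono-≤-nonNeg {p} {q} {r} {s} 0≤p 0≤s p≤q r≤s =
  ≤-trans (*-monoˡ-≤-nonNeg p {{nonNegative 0≤p}} r≤s) (*-monoʳ-≤-nonNeg s {{nonNegative 0≤s}} p≤q)

*-cancelˡ-≤-0< : ∀ {r p q} → 0ℚ < r → r * p ≤ r * q → p ≤ q
*-cancelˡ-≤-0< {r} 0<r = *-cancelˡ-≤-pos r {{positive 0<r}}

0<-* : ∀ {p q} → 0ℚ < p → 0ℚ < q → 0ℚ < p * q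
0<-* {p} {q} 0<p 0<q = subst (_< p * q) (*-zeroʳ p) (*-monoʳ-<-pos p {{positive 0<p}} 0<q)

0<½ε : ∀ {ε} → 0ℚ < ε → 0ℚ < ½ * ε
0<½ε = 0<-* (from-yes (0ℚ <? ½))

½+½ : ∀ ε → ½ * ε + ½ * ε ≡ ε
½+½ = solve-∀ ℚ-ring

p≤∣p∣ : ∀ p → p ≤ ∣ p ∣
p≤∣p∣ p with ≤-total 0ℚ p
... | inj₁ 0≤p = ≤-reflexive (sym (0≤p⇒∣p∣≡p 0≤p))
... | inj₂ p≤0 = ≤-trans p≤0 (0≤∣p∣ p)

-p≤∣p∣ : ∀ p → - p ≤ ∣ p ∣
-p≤∣p∣ p = subst (- p ≤_) (∣-p∣≡∣p∣ p) (p≤∣p∣ (- p))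

-- Sequences

Eventually : Pred ℕ 0ℓ → Set
Eventually P = ∃[ K ] ∀ n → K ≤ℕ n → P n

infixr 2 _&_

_&_ : ∀ {P Q} → Eventually P → Eventually Q → Eventually (λ n → P n × Q n)
(K , p) & (L , q) = K ℕ.⊔ L , λ n h →
  p n (ℕ.≤-trans (ℕ.m≤m⊔n K L) h) , q n (ℕ.≤-trans (ℕ.m≤n⊔m K L) h)

Eventually-map : ∀ {P Q} → (∀ n → P n → Q n) → Eventually P → Eventually Q
Eventually-map f (K , p) = K , λ n h → f n (p n h)

Null Bounded : Seq → Set
Null a = ∀ ε → 0ℚ < ε → Eventually λ n → ∣ a n ∣ ≤ ε
Bounded a = ∃[ B ] 0ℚ < B × Eventually λ n → ∣ a n ∣ ≤ B

Null-dominated : ∀ {a b} → Null a → (∀ n → ∣ b n ∣ ≤ ∣ a n ∣) → Null b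
Null-dominated null-a h ε 0<ε = Eventually-map (λ n → ≤-trans (h n)) (null-a ε 0<ε)

Null-resp : ∀ {a b} → (∀ n → a n ≡ b n) → Null a → Null b
Null-resp e null-a = Null-dominated null-a λ n → ≤-reflexive (cong ∣_∣ (sym (e n)))

Null-+ : ∀ {a b} → Null a → Null b → Null λ n → a n + b n
Null-+ {a} {b} null-a null-b ε 0<ε = Eventually-map
  (λ n (p , q) → ≤-trans (∣p+q∣≤∣p∣+∣q∣ (a n) (b n)) (subst (∣ a n ∣ + ∣ b n ∣ ≤_) (½+½ ε) (+-mono-≤ p q)))
  (null-a (½ * ε) (0<½ε 0<ε) & null-b (½ * ε) (0<½ε 0<ε))

Null-neg : ∀ {a} → Null a → Null λ n → - a n
Null-neg {a} null-a = Null-dominated null-a λ n → ≤-reflexive (∣-p∣≡∣p∣ (a n))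

Null-- : ∀ {a b} → Null a → Null b → Null λ n → a n - b n
Null-- null-a null-b = Null-+ null-a (Null-neg null-b)

Null-*-Bounded : ∀ {a b} → Null a → Bounded b → Null λ n → a n * b n
Null-*-Bounded {a} {b} null-a (B , 0<B , bound) ε 0<ε = Eventually-map
  (λ n (p , q) → subst₂ _≤_ (sym (∣p*q∣≡∣p∣*∣q∣ (a n) (b n))) cancel
    (*-mono-≤-nonNeg (0≤∣p∣ (a n)) (<⇒≤ 0<B) p q))
  (null-a (ε * 1/B) (0<-* 0<ε 0<1/B) & bound)
  where
  instance
    B-pos : Positive B
    B-pos = positive 0<B
    B-nonZero : NonZero B
    B-nonZero = pos⇒nonZero B
  1/B : ℚ
  1/B = 1/ B
  0<1/B : 0ℚ < 1/B
  0<1/B = positive⁻¹ 1/B {{1/pos⇒pos B}}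
  cancel : ε * 1/B * B ≡ ε
  cancel = trans (*-assoc ε 1/B B) (trans (cong (ε *_) (*-inverseˡ B)) (*-identityʳ ε))

Bounded-+ : ∀ {a b} → Bounded a → Bounded b → Bounded λ n → a n + b n
Bounded-+ {a} {b} (A , 0<A , p) (B , 0<B , q) = A + B , +-mono-< 0<A 0<B ,
  Eventually-map (λ n (p , q) → ≤-trans (∣p+q∣≤∣p∣+∣q∣ (a n) (b n)) (+-mono-≤ p q)) (p & q)

Bounded-neg : ∀ {a} → Bounded a → Bounded λ n → - a n
Bounded-neg {a} (A , 0<A , p) =
  A , 0<A , Eventually-map (λ n → ≤-trans (≤-reflexive (∣-p∣≡∣p∣ (a n)))) p

Bounded-* : ∀ {a b} → Bounded a → Bounded b → Bounded λ n → a n * b n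
Bounded-* {a} {b} (A , 0<A , p) (B , 0<B , q) = A * B , 0<-* 0<A 0<B ,
  Eventually-map (λ n (p , q) → subst (_≤ A * B) (sym (∣p*q∣≡∣p∣*∣q∣ (a n) (b n)))
    (*-mono-≤-nonNeg (0≤∣p∣ (a n)) (<⇒≤ 0<B) p q)) (p & q)

Bounded-const : ∀ p → Bounded λ _ → p
Bounded-const p = ∣ p ∣ + 1ℚ , +-mono-≤-< (0≤∣p∣ p) (from-yes (0ℚ <? 1ℚ)) , 0 , λ _ _ →
  subst (_≤ ∣ p ∣ + 1ℚ) (+-identityʳ ∣ p ∣) (+-monoʳ-≤ ∣ p ∣ (from-yes (0ℚ ≤? 1ℚ)))

Bounded-resp : ∀ {a b} → (∀ n → a n ≡ b n) → Bounded a → Bounded b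
Bounded-resp e (A , 0<A , p) = A , 0<A , Eventually-map (λ n → subst (λ p → ∣ p ∣ ≤ A) (e n)) p

Cauchy⇒Bounded : ∀ {a} → a ∈ Cauchy → Bounded a
Cauchy⇒Bounded {a} cauchy with cauchy 1ℚ (from-yes (0ℚ <? 1ℚ))
... | K , close = ∣ a K ∣ + 1ℚ , +-mono-≤-< (0≤∣p∣ (a K)) (from-yes (0ℚ <? 1ℚ)) , K , λ n h →
  subst (_≤ ∣ a K ∣ + 1ℚ) (cong ∣_∣ (lem (a K) (a n)))
    (≤-trans (∣p+q∣≤∣p∣+∣q∣ (a K) (a n - a K)) (+-monoʳ-≤ ∣ a K ∣ (close n K h ℕ.≤-refl)))
  where
  lem : ∀ p q → p + (q - p) ≡ q
  lem = solve-∀ ℚ-ring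

-- Finite sums

sum-cong : ∀ n {f g} → (∀ i → i <ℕ n → f i ≡ g i) → sumBelow n f ≡ sumBelow n g
sum-cong zero    e = refl
sum-cong (suc n) e = cong₂ _+_ (sum-cong n λ i h → e i (ℕ.m≤n⇒m≤1+n h)) (e n ℕ.≤-refl)

sum-*ˡ : ∀ n c f → sumBelow n (λ i → c * f i) ≡ c * sumBelow n f
sum-*ˡ zero    c f = sym (*-zeroʳ c)
sum-*ˡ (suc n) c f = trans (cong (_+ c * f n) (sum-*ˡ n c f)) (sym (*-distribˡ-+ c _ _))

sum-+ : ∀ n f g → sumBelow n (λ i → f i + g i) ≡ sumBelow n f + sumBelow n g
sum-+ zero    f g = refl
sum-+ (suc n) f g = trans (cong (_+ (f n + g n)) (sum-+ n f g)) (lem (sumBelow n f) (sumBelow n g) (f n) (g n))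
  where
  lem : ∀ a b c d → a + b + (c + d) ≡ a + c + (b + d)
  lem = solve-∀ ℚ-ring

sum-neg : ∀ n f → sumBelow n (λ i → - f i) ≡ - sumBelow n f
sum-neg zero    f = refl
sum-neg (suc n) f = trans (cong (_- f n) (sum-neg n f)) (sym (neg-distrib-+ (sumBelow n f) (f n)))

sum-first : ∀ n f → sumBelow (suc n) f ≡ f 0 + sumBelow n (λ i → f (suc i))
sum-first zero    f = trans (+-identityˡ (f 0)) (sym (+-identityʳ (f 0)))
sum-first (suc n) f = trans (cong (_+ f (suc n)) (sum-first n f)) (+-assoc (f 0) _ _)

sum-mono-≤ : ∀ n {f g} → (∀ i → f i ≤ g i) → sumBelow n f ≤ sumBelow n g
sum-mono-≤ zero    h = ≤-refl
sum-mono-≤ (suc n) h = +-mono-≤ (sum-mono-≤ n h) (h n)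

∣sum∣≤ : ∀ n {f h} → (∀ i → ∣ f i ∣ ≤ h i) → ∣ sumBelow n f ∣ ≤ sumBelow n h
∣sum∣≤ zero            le = ≤-refl
∣sum∣≤ (suc n) {f} {h} le =
  ≤-trans (∣p+q∣≤∣p∣+∣q∣ (sumBelow n f) (f n)) (+-mono-≤ (∣sum∣≤ n le) (le n))

∣tail∣≤ : ∀ m n {f h} → m ≤ℕ n → (∀ i → ∣ f i ∣ ≤ h i) →
          ∣ sumBelow n f - sumBelow m f ∣ ≤ sumBelow n h - sumBelow m h
∣tail∣≤ m n m≤n le = go (ℕ.≤⇒≤′ m≤n)
  where
  lem : ∀ a b c → a + b - c ≡ a - c + b
  lem = solve-∀ ℚ-ring
  go : ∀ {n} → m ℕ.≤′ n → ∣ sumBelow n _ - sumBelow m _ ∣ ≤ sumBelow n _ - sumBelow m _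
  go (ℕ.≤′-reflexive refl) = ≤-reflexive (trans (cong ∣_∣ (+-inverseʳ (sumBelow m _))) (sym (+-inverseʳ (sumBelow m _))))
  go (ℕ.≤′-step {n} m≤n) = subst₂ _≤_ (cong ∣_∣ (sym (lem (sumBelow n _) _ _))) (sym (lem (sumBelow n _) _ _))
    (≤-trans (∣p+q∣≤∣p∣+∣q∣ (sumBelow n _ - sumBelow m _) _) (+-mono-≤ (go m≤n) (le n)))

sum-extend : ∀ m n {h} → m ≤ℕ n → (∀ i → 0ℚ ≤ h i) → sumBelow m h ≤ sumBelow n h
sum-extend m n {h} m≤n nonneg = 0≤⇒≤
  (≤-trans (0≤∣p∣ _) (∣tail∣≤ m n {h} {h} m≤n λ i → ≤-reflexive (0≤p⇒∣p∣≡p (nonneg i)))) refl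

-- The Cauchy product

square triangle : ℕ → (ℕ → ℕ → ℚ) → ℚ
square   m h = sumBelow m λ i → sumBelow m (h i)
triangle m h = sumBelow m λ i → sumBelow (m ∸ i) (h i)

diagonal : ℕ → (ℕ → ℕ → ℚ) → ℚ
diagonal k h = sumBelow (suc k) λ i → h i (k ∸ i)

triangle-suc : ∀ m h → triangle (suc m) h ≡ triangle m h + diagonal m h
triangle-suc m h = begin
  triangle (suc m) h
    ≡⟨ sum-cong (suc m) (λ i i≤m → cong (λ l → sumBelow l (h i)) (ℕ.+-∸-assoc 1 (ℕ.≤-pred i≤m))) ⟩
  sumBelow (suc m) (λ i → sumBelow (m ∸ i) (h i) + h i (m ∸ i))
    ≡⟨ sum-+ (suc m) (λ i → sumBelow (m ∸ i) (h i)) (λ i → h i (m ∸ i)) ⟩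
  triangle m h + sumBelow (m ∸ m) (h m) + diagonal m h
    ≡⟨ cong (λ l → triangle m h + sumBelow l (h m) + diagonal m h) (ℕ.n∸n≡0 m) ⟩
  triangle m h + 0ℚ + diagonal m h
    ≡⟨ cong (_+ diagonal m h) (+-identityʳ (triangle m h)) ⟩
  triangle m h + diagonal m h ∎
  where open ≡-Reasoning

triangle-diagonals : ∀ m h → triangle m h ≡ sumBelow m (λ k → diagonal k h)
triangle-diagonals zero    h = refl
triangle-diagonals (suc m) h = trans (triangle-suc m h) (cong (_+ diagonal m h) (triangle-diagonals m h))

square-product : ∀ m f g → square m (λ i j → f i * g j) ≡ sumBelow m f * sumBelow m g
square-product m f g = begin
  sumBelow m (λ i → sumBelow m (λ j → f i * g j))  ≡⟨ sum-cong m (λ i _ → trans (sum-*ˡ m (f i) g) (*-comm (f i) _)) ⟩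
  sumBelow m (λ i → sumBelow m g * f i)            ≡⟨ sum-*ˡ m (sumBelow m g) f ⟩
  sumBelow m g * sumBelow m f                      ≡⟨ *-comm (sumBelow m g) _ ⟩
  sumBelow m f * sumBelow m g                      ∎
  where open ≡-Reasoning

-- The difference runs over the cells with i, j < m and i + j ≥ m, so a majorant of the cells
-- majorizes it row by row.
∣square-triangle∣≤ : ∀ m {g h} → (∀ i j → ∣ g i j ∣ ≤ h i j) →
                     ∣ square m g - triangle m g ∣ ≤ square m h - triangle m h
∣square-triangle∣≤ m {g} {h} le = subst₂ _≤_ (cong ∣_∣ (differences g)) (differences h)
  (∣sum∣≤ m λ i → ∣tail∣≤ (m ∸ i) m (ℕ.m∸n≤m m i) (le i))
  where
  differences : ∀ g → sumBelow m (λ i → sumBelow m (g i) - sumBelow (m ∸ i) (g i)) ≡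
                      square m g - triangle m g
  differences g = trans (sum-+ m (λ i → sumBelow m (g i)) (λ i → - sumBelow (m ∸ i) (g i)))
    (cong (λ s → square m g + s) (sum-neg m (λ i → sumBelow (m ∸ i) (g i))))

-- Cells with i, j < m satisfy i + j < 2m.
square≤triangle : ∀ m {h} → (∀ i j → 0ℚ ≤ h i j) → square m h ≤ triangle (m ℕ.+ m) h
square≤triangle m {h} nonneg = ≤-trans
  (subst (square m h ≤_) refl (rows m ℕ.≤-refl))
  (sum-extend m (m ℕ.+ m) (ℕ.m≤m+n m m) λ i → sum-nonneg (m ℕ.+ m ∸ i) (nonneg i))
  where
  sum-nonneg : ∀ n {f} → (∀ i → 0ℚ ≤ f i) → 0ℚ ≤ sumBelow n f
  sum-nonneg n nonneg = sum-extend 0 n z≤n nonneg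
  rows : ∀ l → l ≤ℕ m → sumBelow l (λ i → sumBelow m (h i)) ≤ sumBelow l (λ i → sumBelow (m ℕ.+ m ∸ i) (h i))
  rows zero    _   = ≤-refl
  rows (suc l) l<m = +-mono-≤ (rows l (ℕ.<⇒≤ l<m)) (sum-extend m (m ℕ.+ m ∸ l)
    (subst (_≤ℕ m ℕ.+ m ∸ l) (ℕ.m+n∸n≡m m m) (ℕ.∸-monoʳ-≤ (m ℕ.+ m) (ℕ.<⇒≤ l<m))) (nonneg l))

-- Integers and natural numbers as rationals

ι : ℕ → ℚ
ι n = + n / 1

toℚᵘ-/ : ∀ i d .{{_ : ℕ.NonZero d}} → toℚᵘ (i / d) ℚᵘ.≃ (i ℚᵘ./ d)
toℚᵘ-/ i (suc d) = toℚᵘ-fromℚᵘ (ℚᵘ.mkℚᵘ i d)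

/1-+ : ∀ i j → (i ℤ.+ j) / 1 ≡ i / 1 + j / 1
/1-+ i j = toℚᵘ-injective (ℚᵘ.≃-trans (toℚᵘ-/ (i ℤ.+ j) 1) (ℚᵘ.≃-sym
  (ℚᵘ.≃-trans (toℚᵘ-homo-+ (i / 1) (j / 1))
  (ℚᵘ.≃-trans (ℚᵘ.+-cong (toℚᵘ-/ i 1) (toℚᵘ-/ j 1)) (ℚᵘ.*≡* (lem i j))))))
  where
  lem : ∀ i j → (i ℤ.* 1ℤ ℤ.+ j ℤ.* 1ℤ) ℤ.* 1ℤ ≡ (i ℤ.+ j) ℤ.* 1ℤ
  lem = ℤ.solve-∀

/1-* : ∀ i j → (i ℤ.* j) / 1 ≡ (i / 1) * (j / 1)
/1-* i j = toℚᵘ-injective (ℚᵘ.≃-trans (toℚᵘ-/ (i ℤ.* j) 1) (ℚᵘ.≃-sym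
  (ℚᵘ.≃-trans (toℚᵘ-homo-* (i / 1) (j / 1)) (ℚᵘ.*-cong (toℚᵘ-/ i 1) (toℚᵘ-/ j 1)))))

ι-suc : ∀ n → ι (suc n) ≡ 1ℚ + ι n
ι-suc n = /1-+ 1ℤ (+ n)

0≤ι : ∀ n → 0ℚ ≤ ι n
0≤ι n = nonNegative⁻¹ (ι n) {{normalize-nonNeg n 1}}

0<ι-suc : ∀ n → 0ℚ < ι (suc n)
0<ι-suc n = positive⁻¹ (ι (suc n)) {{normalize-pos (suc n) 1}}

ι-mono-≤ : ∀ {m n} → m ≤ℕ n → ι m ≤ ι n
ι-mono-≤ {m} {n} m≤n = subst (ι m ≤_) (trans (sym (/1-+ (+ m) (+ (n ∸ m)))) (cong ι (ℕ.m+[n∸m]≡n m≤n)))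
  (subst (_≤ ι m + ι (n ∸ m)) (+-identityʳ (ι m)) (+-monoʳ-≤ (ι m) (0≤ι (n ∸ m))))

archimedean : ∀ p → ∃[ n ] p ≤ ι n
archimedean p@(mkℚ num d-1 _) = ℤ.∣ num ∣ , toℚᵘ-cancel-≤
  (ℚᵘ.≤-trans (ℚᵘ.*≤* le) (ℚᵘ.≤-reflexive (ℚᵘ.≃-sym (toℚᵘ-/ (+ ℤ.∣ num ∣) 1))))
  where
  le : num ℤ.* 1ℤ ℤ.≤ + ℤ.∣ num ∣ ℤ.* + suc d-1
  le = ℤ.≤-trans (ℤ.≤-reflexive (ℤ.*-identityʳ num)) (ℤ.≤-trans (i≤∣i∣ num)
    (subst (ℤ._≤ + ℤ.∣ num ∣ ℤ.* + suc d-1) (ℤ.*-identityʳ (+ ℤ.∣ num ∣))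
      (ℤ.*-monoˡ-≤-nonNeg (+ ℤ.∣ num ∣) (ℤ.+≤+ (s≤s z≤n)))))

ι-*-reciprocal : ∀ m d .{{_ : ℕ.NonZero m}} .{{_ : ℕ.NonZero d}} .{{_ : ℕ.NonZero (m ℕ.* d)}} →
                 ι m * (+ 1 / (m ℕ.* d)) ≡ + 1 / d
ι-*-reciprocal m@(suc _) d@(suc d-1) = toℚᵘ-injective
  (ℚᵘ.≃-trans (toℚᵘ-homo-* (ι m) (+ 1 / (m ℕ.* d)))
  (ℚᵘ.≃-trans (ℚᵘ.*-cong (toℚᵘ-/ (+ m) 1) (toℚᵘ-/ (+ 1) (m ℕ.* d)))
  (ℚᵘ.≃-trans (ℚᵘ.*≡* (cong +_ lem)) (ℚᵘ.≃-sym (toℚᵘ-/ (+ 1) d)))))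
  where
  lem : m ℕ.* 1 ℕ.* d ≡ 1 ℕ.* (1 ℕ.* (m ℕ.* d))
  lem = trans (cong (ℕ._* d) (ℕ.*-identityʳ m))
              (sym (trans (ℕ.*-identityˡ (1 ℕ.* (m ℕ.* d))) (ℕ.*-identityˡ (m ℕ.* d))))

invFactorial-suc : ∀ n → ι (suc n) * invFactorial (suc n) ≡ invFactorial n
invFactorial-suc n = ι-*-reciprocal (suc n) (n !) {{_}} {{n ℕ.!≢0}} {{suc n ℕ.!≢0}}

-- The exponential series

expTerm : ℕ → ℚ → ℚ
expTerm k a = a ^ k * invFactorial k

expSum : ℕ → ℚ → ℚ
expSum m a = sumBelow m λ k → expTerm k a

expTerm-suc : ∀ k a → ι (suc k) * expTerm (suc k) a ≡ a * expTerm k a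
expTerm-suc k a = trans (lem (ι (suc k)) a (a ^ k) (invFactorial (suc k)))
  (cong (λ f → a * (a ^ k * f)) (invFactorial-suc k))
  where
  lem : ∀ i a p f → i * (a * p * f) ≡ a * (p * (i * f))
  lem = solve-∀ ℚ-ring

0≤expTerm : ∀ k {a} → 0ℚ ≤ a → 0ℚ ≤ expTerm k a
0≤expTerm k {a} 0≤a = 0≤-* (0≤^ k) (nonNegative⁻¹ (invFactorial k) {{normalize-nonNeg 1 (k !) {{k ℕ.!≢0}}}})
  where
  0≤^ : ∀ k → 0ℚ ≤ a ^ k
  0≤^ zero    = from-yes (0ℚ ≤? 1ℚ)
  0≤^ (suc k) = 0≤-* 0≤a (0≤^ k)

∣expTerm∣ : ∀ k a → ∣ expTerm k a ∣ ≡ expTerm k ∣ a ∣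
∣expTerm∣ k a = trans (∣p*q∣≡∣p∣*∣q∣ (a ^ k) (invFactorial k)) (cong₂ _*_ (∣^∣ k)
  (0≤p⇒∣p∣≡p (nonNegative⁻¹ (invFactorial k) {{normalize-nonNeg 1 (k !) {{k ℕ.!≢0}}}})))
  where
  ∣^∣ : ∀ k → ∣ a ^ k ∣ ≡ ∣ a ∣ ^ k
  ∣^∣ zero    = refl
  ∣^∣ (suc k) = trans (∣p*q∣≡∣p∣*∣q∣ a (a ^ k)) (cong (∣ a ∣ *_) (∣^∣ k))

expTerm-mono-≤ : ∀ k {a b} → 0ℚ ≤ a → a ≤ b → expTerm k a ≤ expTerm k b
expTerm-mono-≤ zero    0≤a a≤b = ≤-refl
expTerm-mono-≤ (suc k) {a} {b} 0≤a a≤b = *-cancelˡ-≤-0< (0<ι-suc k)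
  (subst₂ _≤_ (sym (expTerm-suc k a)) (sym (expTerm-suc k b))
    (*-mono-≤-nonNeg 0≤a (0≤expTerm k (≤-trans 0≤a a≤b)) a≤b (expTerm-mono-≤ k 0≤a a≤b)))

-- The binomial theorem: both sides satisfy the recursion of expTerm-suc.

convolution : ℚ → ℚ → ℕ → ℕ → ℚ
convolution a b i j = expTerm i a * expTerm j b

-- A Leibniz rule: the weight k + 1 splits as i + (k + 1 - i), and each summand lowers the exponent
-- of its own factor.
ι-*-diagonal : ∀ k a b → ι (suc k) * diagonal (suc k) (convolution a b) ≡ (a + b) * diagonal k (convolution a b)
ι-*-diagonal k a b = begin
  ι (suc k) * diagonal (suc k) (convolution a b)
    ≡⟨ sym (sum-*ˡ (suc (suc k)) (ι (suc k)) f) ⟩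
  sumBelow (suc (suc k)) (λ i → ι (suc k) * f i)
    ≡⟨ sum-cong (suc (suc k)) (λ i i<2+k →
         trans (cong (_* f i) (split i (ℕ.≤-pred i<2+k))) (*-distribʳ-+ (f i) (ι i) (ι (suc k ∸ i)))) ⟩
  sumBelow (suc (suc k)) (λ i → ι i * f i + ι (suc k ∸ i) * f i)
    ≡⟨ sum-+ (suc (suc k)) (λ i → ι i * f i) (λ i → ι (suc k ∸ i) * f i) ⟩
  sumBelow (suc (suc k)) (λ i → ι i * f i) + sumBelow (suc (suc k)) (λ i → ι (suc k ∸ i) * f i)
    ≡⟨ cong₂ _+_ left right ⟩
  a * diagonal k (convolution a b) + b * diagonal k (convolution a b)
    ≡⟨ sym (*-distribʳ-+ (diagonal k (convolution a b)) a b) ⟩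
  (a + b) * diagonal k (convolution a b) ∎
  where
  open ≡-Reasoning
  f : ℕ → ℚ
  f i = expTerm i a * expTerm (suc k ∸ i) b

  split : ∀ i → i ≤ℕ suc k → ι (suc k) ≡ ι i + ι (suc k ∸ i)
  split i i≤ = trans (cong ι (sym (ℕ.m+[n∸m]≡n i≤))) (/1-+ (+ i) (+ (suc k ∸ i)))

  assoc : ∀ c x y d z → c * x ≡ d * z → c * (x * y) ≡ d * (z * y)
  assoc c x y d z e = trans (sym (*-assoc c x y)) (trans (cong (_* y) e) (*-assoc d z y))

  left : sumBelow (suc (suc k)) (λ i → ι i * f i) ≡ a * diagonal k (convolution a b)
  left = begin
    sumBelow (suc (suc k)) (λ i → ι i * f i)
      ≡⟨ sum-first (suc k) (λ i → ι i * f i) ⟩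
    ι 0 * f 0 + sumBelow (suc k) (λ i → ι (suc i) * f (suc i))
      ≡⟨ cong₂ _+_ (*-zeroˡ (f 0)) (sum-cong (suc k) λ i _ →
           assoc (ι (suc i)) (expTerm (suc i) a) (expTerm (k ∸ i) b) a (expTerm i a) (expTerm-suc i a)) ⟩
    0ℚ + sumBelow (suc k) (λ i → a * (expTerm i a * expTerm (k ∸ i) b))
      ≡⟨ +-identityˡ _ ⟩
    sumBelow (suc k) (λ i → a * (expTerm i a * expTerm (k ∸ i) b))
      ≡⟨ sum-*ˡ (suc k) a (λ i → expTerm i a * expTerm (k ∸ i) b) ⟩
    a * diagonal k (convolution a b) ∎

  right : sumBelow (suc (suc k)) (λ i → ι (suc k ∸ i) * f i) ≡ b * diagonal k (convolution a b)
  right = begin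
    sumBelow (suc k) (λ i → ι (suc k ∸ i) * f i) + ι (k ∸ k) * f (suc k)
      ≡⟨ cong₂ _+_ (sum-cong (suc k) step) (trans (cong (λ l → ι l * f (suc k)) (ℕ.n∸n≡0 k)) (*-zeroˡ (f (suc k)))) ⟩
    sumBelow (suc k) (λ i → b * (expTerm i a * expTerm (k ∸ i) b)) + 0ℚ
      ≡⟨ +-identityʳ _ ⟩
    sumBelow (suc k) (λ i → b * (expTerm i a * expTerm (k ∸ i) b))
      ≡⟨ sum-*ˡ (suc k) b (λ i → expTerm i a * expTerm (k ∸ i) b) ⟩
    b * diagonal k (convolution a b) ∎
    where
    step : ∀ i → i <ℕ suc k → ι (suc k ∸ i) * f i ≡ b * (expTerm i a * expTerm (k ∸ i) b)
    step i i≤k rewrite ℕ.+-∸-assoc 1 (ℕ.≤-pred i≤k) = begin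
      ι (suc (k ∸ i)) * (expTerm i a * expTerm (suc (k ∸ i)) b)  ≡⟨ cong (ι (suc (k ∸ i)) *_) (*-comm (expTerm i a) _) ⟩
      ι (suc (k ∸ i)) * (expTerm (suc (k ∸ i)) b * expTerm i a)  ≡⟨ assoc (ι (suc (k ∸ i))) _ (expTerm i a) b _ (expTerm-suc (k ∸ i) b) ⟩
      b * (expTerm (k ∸ i) b * expTerm i a)                      ≡⟨ cong (b *_) (*-comm (expTerm (k ∸ i) b) _) ⟩
      b * (expTerm i a * expTerm (k ∸ i) b)                      ∎

diagonal-convolution : ∀ k a b → diagonal k (convolution a b) ≡ expTerm k (a + b)
diagonal-convolution zero    a b = refl
diagonal-convolution (suc k) a b = ≤-antisym
  (*-cancelˡ-≤-0< (0<ι-suc k) (≤-reflexive e)) (*-cancelˡ-≤-0< (0<ι-suc k) (≤-reflexive (sym e)))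
  where
  e : ι (suc k) * diagonal (suc k) (convolution a b) ≡ ι (suc k) * expTerm (suc k) (a + b)
  e = trans (ι-*-diagonal k a b) (trans (cong ((a + b) *_) (diagonal-convolution k a b)) (sym (expTerm-suc k (a + b))))

-- The square of side m lies between the triangles of sides m and 2m, which are exponential sums by
-- the binomial theorem. So truncating the product costs at most a piece of the exponential tail.
square-convolution≤ : ∀ m {a b} → 0ℚ ≤ a → 0ℚ ≤ b →
  square m (convolution a b) - triangle m (convolution a b) ≤ expSum (m ℕ.+ m) (a + b) - expSum m (a + b)
square-convolution≤ m {a} {b} 0≤a 0≤b = subst
  (λ t → square m (convolution a b) - t ≤ expSum (m ℕ.+ m) (a + b) - expSum m (a + b))
  (sym (triangle≡ m))
  (+-monoˡ-≤ (- expSum m (a + b)) (subst (square m (convolution a b) ≤_) (triangle≡ (m ℕ.+ m))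
    (square≤triangle m λ i j → 0≤-* (0≤expTerm i 0≤a) (0≤expTerm j 0≤b))))
  where
  triangle≡ : ∀ m → triangle m (convolution a b) ≡ expSum m (a + b)
  triangle≡ m = trans (triangle-diagonals m (convolution a b)) (sum-cong m λ k _ → diagonal-convolution k a b)

-- Tails of the exponential series, uniformly on [0, N + 1]

module ExpBound (N : ℕ) where

  -- The successor makes `D` positive, so that `halving` may cancel it.
  D : ℚ
  D = ι (suc N)

  -- From the index 2D on, consecutive terms at `D` have ratio D/(k + 1) ≤ 1/2.
  m₀ : ℕ
  m₀ = suc N ℕ.+ suc N

  0≤D : 0ℚ ≤ D
  0≤D = 0≤ι (suc N)

  0≤term : ∀ k → 0ℚ ≤ expTerm k D
  0≤term k = 0≤expTerm k 0≤D

  halving : ∀ {k} → m₀ ≤ℕ k → expTerm (suc k) D + expTerm (suc k) D ≤ expTerm k D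
  halving {k} m₀≤k = *-cancelˡ-≤-0< (0<ι-suc N) (subst₂ _≤_ (lem D (expTerm (suc k) D)) (expTerm-suc k D)
    (*-monoʳ-≤-nonNeg (expTerm (suc k) D) {{nonNegative (0≤term (suc k))}}
      (subst (_≤ ι (suc k)) (/1-+ (+ suc N) (+ suc N)) (ι-mono-≤ (ℕ.m≤n⇒m≤1+n m₀≤k)))))
    where
    lem : ∀ d t → (d + d) * t ≡ d * (t + t)
    lem = solve-∀ ℚ-ring

  -- If t is a term and t′ the next one, t + 2t′ ≤ 2t. This monotone quantity replaces the summation
  -- of a geometric series.
  sum-decreasing : ∀ n {k} → m₀ ≤ℕ k →
    expSum (n ℕ.+ k) D + (expTerm (n ℕ.+ k) D + expTerm (n ℕ.+ k) D) ≤ expSum k D + (expTerm k D + expTerm k D)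
  sum-decreasing zero    m₀≤k = ≤-refl
  sum-decreasing (suc n) {k} m₀≤k = ≤-trans
    (0≤⇒≤ (0≤-difference (halving (ℕ.≤-trans m₀≤k (ℕ.m≤n+m k n))))
         (lem (expSum (n ℕ.+ k) D) (expTerm (n ℕ.+ k) D) (expTerm (suc n ℕ.+ k) D)))
    (sum-decreasing n m₀≤k)
    where
    lem : ∀ s t t′ → t - (t′ + t′) ≡ s + (t + t) - (s + t + (t′ + t′))
    lem = solve-∀ ℚ-ring

  tail≤ : ∀ n {k} → m₀ ≤ℕ k → expSum (n ℕ.+ k) D - expSum k D ≤ expTerm k D + expTerm k D
  tail≤ n {k} m₀≤k = 0≤⇒≤
    (0≤-+ (0≤-difference (sum-decreasing n m₀≤k)) (0≤-+ (0≤term (n ℕ.+ k)) (0≤term (n ℕ.+ k))))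
    (lem (expSum (n ℕ.+ k) D) (expTerm (n ℕ.+ k) D) (expSum k D) (expTerm k D))
    where
    lem : ∀ s′ t′ s t → s + (t + t) - (s′ + (t′ + t′)) + (t′ + t′) ≡ t + t - (s′ - s)
    lem = solve-∀ ℚ-ring

  sum-bounded : ∀ m → expSum m D ≤ expSum m₀ D + (expTerm m₀ D + expTerm m₀ D)
  sum-bounded m = ≤-trans (sum-extend m (m ℕ.+ m₀) (ℕ.m≤m+n m m₀) 0≤term)
    (0≤⇒≤ (0≤-difference (tail≤ m ℕ.≤-refl))
         (lem (expSum (m ℕ.+ m₀) D) (expSum m₀ D) (expTerm m₀ D + expTerm m₀ D)))
    where
    lem : ∀ s′ s t → t - (s′ - s) ≡ s + t - s′
    lem = solve-∀ ℚ-ring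

  -- One halving pays for the growth of the factor, as n + 2 ≤ 2(n + 1). Decay like 1/n is enough
  -- and fits the Archimedean property directly.
  decay : ∀ n → ι (suc n) * expTerm (n ℕ.+ m₀) D ≤ expTerm m₀ D
  decay zero    = ≤-reflexive (*-identityˡ (expTerm m₀ D))
  decay (suc n) = begin
    ι (suc (suc n)) * t′          ≡⟨ cong (_* t′) (ι-suc (suc n)) ⟩
    (1ℚ + ι (suc n)) * t′         ≤⟨ *-monoʳ-≤-nonNeg t′ {{nonNegative (0≤term (suc n ℕ.+ m₀))}}
                                       (+-monoˡ-≤ (ι (suc n)) (ι-mono-≤ {1} {suc n} (s≤s z≤n))) ⟩
    (ι (suc n) + ι (suc n)) * t′  ≡⟨ lem (ι (suc n)) t′ ⟩
    ι (suc n) * (t′ + t′)         ≤⟨ *-monoˡ-≤-nonNeg (ι (suc n)) {{nonNegative (0≤ι (suc n))}} (halving (ℕ.m≤n+m m₀ n)) ⟩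
    ι (suc n) * expTerm (n ℕ.+ m₀) D  ≤⟨ decay n ⟩
    expTerm m₀ D                  ∎
    where
    open ≤-Reasoning
    t′ : ℚ
    t′ = expTerm (suc n ℕ.+ m₀) D
    lem : ∀ i t → (i + i) * t ≡ i * (t + t)
    lem = solve-∀ ℚ-ring

  terms-vanish : ∀ ε → 0ℚ < ε → Eventually λ m → m₀ ≤ℕ m × expTerm m D ≤ ε
  terms-vanish ε 0<ε with archimedean (expTerm m₀ D * (1/ ε) {{pos⇒nonZero ε {{positive 0<ε}}}})
  ... | n₀ , bound = n₀ ℕ.+ m₀ , λ m h → ℕ.≤-trans (ℕ.m≤n+m m₀ n₀) h , small m h
    where
    instance
      ε-nonZero : NonZero ε
      ε-nonZero = pos⇒nonZero ε {{positive 0<ε}}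
    first≤ : expTerm m₀ D ≤ ι n₀ * ε
    first≤ = subst (_≤ ι n₀ * ε)
      (trans (*-assoc (expTerm m₀ D) (1/ ε) ε) (trans (cong (expTerm m₀ D *_) (*-inverseˡ ε)) (*-identityʳ _)))
      (*-monoʳ-≤-nonNeg ε {{nonNegative (<⇒≤ 0<ε)}} bound)
    small′ : ∀ n → n₀ ≤ℕ n → expTerm (n ℕ.+ m₀) D ≤ ε
    small′ n n₀≤n = *-cancelˡ-≤-0< (0<ι-suc n) (≤-trans (decay n) (≤-trans first≤
      (*-monoʳ-≤-nonNeg ε {{nonNegative (<⇒≤ 0<ε)}} (ι-mono-≤ (ℕ.m≤n⇒m≤1+n n₀≤n)))))
    small : ∀ m → n₀ ℕ.+ m₀ ≤ℕ m → expTerm m D ≤ ε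
    small m h = subst (λ k → expTerm k D ≤ ε) (ℕ.m∸n+n≡m (ℕ.≤-trans (ℕ.m≤n+m m₀ n₀) h))
      (small′ (m ∸ m₀) (subst (_≤ℕ m ∸ m₀) (ℕ.m+n∸n≡m n₀ m₀) (ℕ.∸-monoˡ-≤ m₀ h)))

  -- The threshold does not depend on `a`: in the sine of a sequence, the argument and the number of
  -- terms change together.
  tail-small : ∀ ε → 0ℚ < ε → Eventually λ m → ∀ a → 0ℚ ≤ a → a ≤ D → expSum (m ℕ.+ m) a - expSum m a ≤ ε
  tail-small ε 0<ε = Eventually-map
    (λ m (m₀≤m , small) a 0≤a a≤D → begin
      expSum (m ℕ.+ m) a - expSum m a      ≤⟨ p≤∣p∣ _ ⟩
      ∣ expSum (m ℕ.+ m) a - expSum m a ∣  ≤⟨ ∣tail∣≤ m (m ℕ.+ m) (ℕ.m≤m+n m m) (λ k →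
        ≤-trans (≤-reflexive (0≤p⇒∣p∣≡p (0≤expTerm k 0≤a))) (expTerm-mono-≤ k 0≤a a≤D)) ⟩
      expSum (m ℕ.+ m) D - expSum m D      ≤⟨ tail≤ m m₀≤m ⟩
      expTerm m D + expTerm m D            ≤⟨ +-mono-≤ small small ⟩
      ½ * ε + ½ * ε                        ≡⟨ ½+½ ε ⟩
      ε                                    ∎)
    (terms-vanish (½ * ε) (0<½ε 0<ε))
    where open ≤-Reasoning

-- Sine and cosine

-- The signs 0, 1, 0, −1, 0, … of the sine series; those of the cosine series are shifted by one.

sgn : ℕ → ℚ
sgn zero          = 0ℚ
sgn (suc zero)    = 1ℚ
sgn (suc (suc k)) = - sgn k

sinSum cosSum : ℕ → ℚ → ℚ
sinSum m a = sumBelow m λ k → sgn k * expTerm k a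
cosSum m a = sumBelow m λ k → sgn (suc k) * expTerm k a

∣sgn∣≤1 : ∀ k → ∣ sgn k ∣ ≤ 1ℚ
∣sgn∣≤1 zero          = from-yes (∣ 0ℚ ∣ ≤? 1ℚ)
∣sgn∣≤1 (suc zero)    = ≤-refl
∣sgn∣≤1 (suc (suc k)) = subst (_≤ 1ℚ) (sym (∣-p∣≡∣p∣ (sgn k))) (∣sgn∣≤1 k)

∣sgn*∣≤ : ∀ k p → ∣ sgn k * p ∣ ≤ ∣ p ∣
∣sgn*∣≤ k p = subst₂ _≤_ (sym (∣p*q∣≡∣p∣*∣q∣ (sgn k) p)) (*-identityˡ ∣ p ∣)
  (*-monoʳ-≤-nonNeg ∣ p ∣ {{∣-∣-nonNeg p}} (∣sgn∣≤1 k))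

-- Since `sgn k` is sin(kπ/2), this is the addition theorem at multiples of a right angle. It makes
-- the sign of a cell of the product depend on i + j alone.
sgn-+ : ∀ i j → sgn (i ℕ.+ j) ≡ sgn i * sgn (suc j) + sgn (suc i) * sgn j
sgn-+ zero j = lem (sgn j) (sgn (suc j))
  where
  lem : ∀ s c → s ≡ 0ℚ * c + 1ℚ * s
  lem = solve-∀ ℚ-ring
sgn-+ (suc zero) j = lem (sgn j) (sgn (suc j))
  where
  lem : ∀ s c → c ≡ 1ℚ * c + - 0ℚ * s
  lem = solve-∀ ℚ-ring
sgn-+ (suc (suc i)) j = trans (cong -_ (sgn-+ i j)) (lem (sgn i) (sgn (suc i)) (sgn j) (sgn (suc j)))
  where
  lem : ∀ s c s′ c′ → - (s * c′ + c * s′) ≡ - s * c′ + - c * s′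
  lem = solve-∀ ℚ-ring

-- The two products form one square sum, and the sine of `a + b` is the triangle sum of the same
-- cells. Each cell is dominated by the corresponding cell of the exponential product at `∣ a ∣` and
-- `∣ b ∣`.
addition-error : ∀ m a b →
  ∣ (sinSum m a * cosSum m b + cosSum m a * sinSum m b) - sinSum m (a + b) ∣ ≤
  expSum (m ℕ.+ m) (∣ a ∣ + ∣ b ∣) - expSum m (∣ a ∣ + ∣ b ∣)
addition-error m a b = begin
  ∣ (sinSum m a * cosSum m b + cosSum m a * sinSum m b) - sinSum m (a + b) ∣
    ≡⟨ cong₂ (λ p q → ∣ p - q ∣) square≡ triangle≡ ⟩
  ∣ square m g - triangle m g ∣
    ≤⟨ ∣square-triangle∣≤ m bound ⟩
  square m (convolution ∣ a ∣ ∣ b ∣) - triangle m (convolution ∣ a ∣ ∣ b ∣)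
    ≤⟨ square-convolution≤ m (0≤∣p∣ a) (0≤∣p∣ b) ⟩
  expSum (m ℕ.+ m) (∣ a ∣ + ∣ b ∣) - expSum m (∣ a ∣ + ∣ b ∣) ∎
  where
  open ≤-Reasoning
  g : ℕ → ℕ → ℚ
  g i j = sgn (i ℕ.+ j) * convolution a b i j

  bound : ∀ i j → ∣ g i j ∣ ≤ convolution ∣ a ∣ ∣ b ∣ i j
  bound i j = ≤-trans (∣sgn*∣≤ (i ℕ.+ j) (convolution a b i j)) (≤-reflexive
    (trans (∣p*q∣≡∣p∣*∣q∣ (expTerm i a) (expTerm j b)) (cong₂ _*_ (∣expTerm∣ i a) (∣expTerm∣ j b))))

  f₁ f₂ : ℕ → ℕ → ℚ
  f₁ i j = (sgn i * expTerm i a) * (sgn (suc j) * expTerm j b)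
  f₂ i j = (sgn (suc i) * expTerm i a) * (sgn j * expTerm j b)

  g≡ : ∀ i j → f₁ i j + f₂ i j ≡ g i j
  g≡ i j = trans (lem (sgn i) (sgn (suc i)) (sgn j) (sgn (suc j)) (expTerm i a) (expTerm j b))
                 (cong (_* convolution a b i j) (sym (sgn-+ i j)))
    where
    lem : ∀ s c s′ c′ x y → s * x * (c′ * y) + c * x * (s′ * y) ≡ (s * c′ + c * s′) * (x * y)
    lem = solve-∀ ℚ-ring

  square≡ : sinSum m a * cosSum m b + cosSum m a * sinSum m b ≡ square m g
  square≡ = trans (sym (cong₂ _+_ (square-product m (λ i → sgn i * expTerm i a) (λ j → sgn (suc j) * expTerm j b))
                                  (square-product m (λ i → sgn (suc i) * expTerm i a) (λ j → sgn j * expTerm j b))))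
           (trans (sym (sum-+ m (λ i → sumBelow m (f₁ i)) (λ i → sumBelow m (f₂ i))))
                  (sum-cong m λ i _ → trans (sym (sum-+ m (f₁ i) (f₂ i))) (sum-cong m λ j _ → g≡ i j)))

  triangle≡ : sinSum m (a + b) ≡ triangle m g
  triangle≡ = sym (trans (triangle-diagonals m g) (sum-cong m λ k _ →
    trans (sum-cong (suc k) λ i i≤k → cong (λ l → sgn l * convolution a b i (k ∸ i)) (ℕ.m+[n∸m]≡n (ℕ.≤-pred i≤k)))
    (trans (sum-*ˡ (suc k) (sgn k) (λ i → convolution a b i (k ∸ i)))
           (cong (sgn k *_) (diagonal-convolution k a b)))))

sgn*expTerm-neg : ∀ k a → sgn k * expTerm k (- a) ≡ - (sgn k * expTerm k a)
sgn*expTerm-neg k a = trans (sym (*-assoc (sgn k) ((- a) ^ k) (invFactorial k)))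
  (trans (cong (_* invFactorial k) (go k)) (lem (sgn k) (a ^ k) (invFactorial k)))
  where
  lem : ∀ s p f → - (s * p) * f ≡ - (s * (p * f))
  lem = solve-∀ ℚ-ring
  lem₀ : 0ℚ * 1ℚ ≡ - (0ℚ * 1ℚ)
  lem₀ = refl
  lem₁ : ∀ a → 1ℚ * (- a * 1ℚ) ≡ - (1ℚ * (a * 1ℚ))
  lem₁ = solve-∀ ℚ-ring
  lem₂ : ∀ s a p → - s * (- a * (- a * p)) ≡ - (a * a * (s * p))
  lem₂ = solve-∀ ℚ-ring
  lem₃ : ∀ s a p → - (a * a * - (s * p)) ≡ - (- s * (a * (a * p)))
  lem₃ = solve-∀ ℚ-ring
  go : ∀ k → sgn k * (- a) ^ k ≡ - (sgn k * a ^ k)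
  go zero          = lem₀
  go (suc zero)    = lem₁ a
  go (suc (suc k)) = trans (lem₂ (sgn k) a ((- a) ^ k))
    (trans (cong (λ p → - (a * a * p)) (go k)) (lem₃ (sgn k) a (a ^ k)))

sgn-suc*expTerm-neg : ∀ k a → sgn (suc k) * expTerm k (- a) ≡ sgn (suc k) * expTerm k a
sgn-suc*expTerm-neg k a = trans (sym (*-assoc (sgn (suc k)) ((- a) ^ k) (invFactorial k)))
  (trans (cong (_* invFactorial k) (go k)) (*-assoc (sgn (suc k)) (a ^ k) (invFactorial k)))
  where
  lem₁ : ∀ a → - 0ℚ * (- a * 1ℚ) ≡ - 0ℚ * (a * 1ℚ)
  lem₁ = solve-∀ ℚ-ring
  lem₂ : ∀ s a p → - s * (- a * (- a * p)) ≡ - (a * a * (s * p))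
  lem₂ = solve-∀ ℚ-ring
  lem₃ : ∀ s a p → - (a * a * (s * p)) ≡ - s * (a * (a * p))
  lem₃ = solve-∀ ℚ-ring
  go : ∀ k → sgn (suc k) * (- a) ^ k ≡ sgn (suc k) * a ^ k
  go zero          = refl
  go (suc zero)    = lem₁ a
  go (suc (suc k)) = trans (lem₂ (sgn (suc k)) a ((- a) ^ k))
    (trans (cong (λ p → - (a * a * p)) (go k)) (lem₃ (sgn (suc k)) a (a ^ k)))

sinSum-neg : ∀ m a → sinSum m (- a) ≡ - sinSum m a
sinSum-neg m a = trans (sum-cong m λ k _ → sgn*expTerm-neg k a) (sum-neg m (λ k → sgn k * expTerm k a))

cosSum-neg : ∀ m a → cosSum m (- a) ≡ cosSum m a
cosSum-neg m a = sum-cong m λ k _ → sgn-suc*expTerm-neg k a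

signs : ∀ j → (- 1ℚ) ^ j ≡ sgn (suc (2 ℕ.* j)) × sgn (2 ℕ.* j) ≡ 0ℚ
signs zero    = refl , refl
signs (suc j) with signs j
... | odd , even =
    trans (cong (- 1ℚ *_) odd) (trans (lem (sgn (suc (2 ℕ.* j)))) (cong (λ k → sgn (suc k)) (sym (ℕ.*-suc 2 j))))
  , trans (cong sgn (ℕ.*-suc 2 j)) (cong -_ even)
  where
  lem : ∀ s → - 1ℚ * s ≡ - s
  lem = solve-∀ ℚ-ring

-- The even exponents below 2n enter with sign 0. Summing over all exponents lets one Cauchy product
-- serve sine and cosine alike.
sin≡sinSum : ∀ a n → sin a n ≡ sinSum (2 ℕ.* n) (a n)
sin≡sinSum a n = go n
  where
  α : ℚ
  α = a n
  go : ∀ n → sumBelow n (λ j → (- 1ℚ) ^ j * α ^ suc (2 ℕ.* j) * invFactorial (suc (2 ℕ.* j))) ≡ sinSum (2 ℕ.* n) α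
  go zero = refl
  go (suc n) = trans (trans
    (cong₂ _+_ (go n) (trans (*-assoc ((- 1ℚ) ^ n) _ _) (cong (_* expTerm (suc (2 ℕ.* n)) α) (proj₁ (signs n)))))
    (trans (lem (sinSum (2 ℕ.* n) α) (expTerm (2 ℕ.* n) α) _)
           (cong (λ s → sinSum (2 ℕ.* n) α + s * expTerm (2 ℕ.* n) α + sgn (suc (2 ℕ.* n)) * expTerm (suc (2 ℕ.* n)) α)
                 (sym (proj₂ (signs n))))))
    (cong (λ m → sinSum m α) (sym (ℕ.*-suc 2 n)))
    where
    lem : ∀ p e q → p + q ≡ p + 0ℚ * e + q
    lem = solve-∀ ℚ-ring

cos≡cosSum : ∀ a n → cos a n ≡ cosSum (2 ℕ.* n) (a n)
cos≡cosSum a n = go n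
  where
  α : ℚ
  α = a n
  go : ∀ n → sumBelow n (λ j → (- 1ℚ) ^ j * α ^ (2 ℕ.* j) * invFactorial (2 ℕ.* j)) ≡ cosSum (2 ℕ.* n) α
  go zero = refl
  go (suc n) = trans (trans
    (cong₂ _+_ (go n) (trans (*-assoc ((- 1ℚ) ^ n) _ _) (cong (_* expTerm (2 ℕ.* n) α) (proj₁ (signs n)))))
    (trans (lem (cosSum (2 ℕ.* n) α) (expTerm (suc (2 ℕ.* n)) α) _)
           (cong (λ s → cosSum (2 ℕ.* n) α + sgn (suc (2 ℕ.* n)) * expTerm (2 ℕ.* n) α + - s * expTerm (suc (2 ℕ.* n)) α)
                 (sym (proj₂ (signs n))))))
    (cong (λ m → cosSum m α) (sym (ℕ.*-suc 2 n)))
    where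
    lem : ∀ p e q → p + q ≡ p + q + - 0ℚ * e
    lem = solve-∀ ℚ-ring

signed-sum-bounded : ∀ (f : ℕ → ℕ) {a} → Bounded a →
  Bounded λ n → sumBelow (2 ℕ.* n) λ k → sgn (f k) * expTerm k (a n)
signed-sum-bounded f {a} (A , 0<A , bound) with archimedean A
... | N , A≤N = M , 0<M , Eventually-map le bound
  where
  open ExpBound N
  open ≤-Reasoning
  M₀ M : ℚ
  M₀ = expSum m₀ D + (expTerm m₀ D + expTerm m₀ D)
  M  = M₀ + 1ℚ
  0<M : 0ℚ < M
  0<M = +-mono-≤-< (sum-bounded 0) (from-yes (0ℚ <? 1ℚ))
  le : ∀ n → ∣ a n ∣ ≤ A → ∣ sumBelow (2 ℕ.* n) (λ k → sgn (f k) * expTerm k (a n)) ∣ ≤ M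
  le n h = begin
    ∣ sumBelow (2 ℕ.* n) (λ k → sgn (f k) * expTerm k (a n)) ∣
      ≤⟨ ∣sum∣≤ (2 ℕ.* n) (λ k → ≤-trans (∣sgn*∣≤ (f k) (expTerm k (a n))) (≤-trans (≤-reflexive (∣expTerm∣ k (a n)))
           (expTerm-mono-≤ k (0≤∣p∣ (a n)) (≤-trans h (≤-trans A≤N (ι-mono-≤ (ℕ.n≤1+n N))))))) ⟩
    expSum (2 ℕ.* n) D  ≤⟨ sum-bounded (2 ℕ.* n) ⟩
    M₀                  ≡⟨ sym (+-identityʳ M₀) ⟩
    M₀ + 0ℚ             ≤⟨ +-monoʳ-≤ M₀ (from-yes (0ℚ ≤? 1ℚ)) ⟩
    M                   ∎

sin-Bounded : ∀ {a} → Bounded a → Bounded (sin a)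
sin-Bounded {a} b = Bounded-resp (λ n → sym (sin≡sinSum a n)) (signed-sum-bounded (λ k → k) b)

cos-Bounded : ∀ {a} → Bounded a → Bounded (cos a)
cos-Bounded {a} b = Bounded-resp (λ n → sym (cos≡cosSum a n)) (signed-sum-bounded suc b)

sin-+ : ∀ {a b} → Bounded a → Bounded b →
        Null λ n → (sin a n * cos b n + cos a n * sin b n) - sin (λ n → a n + b n) n
sin-+ {a} {b} (A , 0<A , p) (B , 0<B , q) with archimedean (A + B)
... | N , A+B≤N = λ ε 0<ε → Eventually-map (λ n (p , q , h) → le ε n p q h)
                   (p & q & double (tail-small ε 0<ε))
  where
  open ExpBound N
  -- The sine at index n sums the exponents below 2n, so the tail estimate is taken at 2n.
  double : ∀ {P} → Eventually P → Eventually λ n → P (2 ℕ.* n)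
  double (K , h) = K , λ n K≤n → h (2 ℕ.* n) (ℕ.≤-trans K≤n (ℕ.m≤m+n n _))
  le : ∀ ε n → ∣ a n ∣ ≤ A → ∣ b n ∣ ≤ B →
       (∀ c → 0ℚ ≤ c → c ≤ D → expSum (2 ℕ.* n ℕ.+ 2 ℕ.* n) c - expSum (2 ℕ.* n) c ≤ ε) →
       ∣ (sin a n * cos b n + cos a n * sin b n) - sin (λ n → a n + b n) n ∣ ≤ ε
  le ε n p q h = subst (λ e → ∣ e ∣ ≤ ε)
    (sym (cong₂ _-_ (cong₂ _+_ (cong₂ _*_ (sin≡sinSum a n) (cos≡cosSum b n)) (cong₂ _*_ (cos≡cosSum a n) (sin≡sinSum b n)))
                    (sin≡sinSum (λ n → a n + b n) n)))
    (≤-trans (addition-error (2 ℕ.* n) (a n) (b n)) (h (∣ a n ∣ + ∣ b n ∣)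
      (0≤-+ (0≤∣p∣ (a n)) (0≤∣p∣ (b n)))
      (≤-trans (+-mono-≤ p q) (≤-trans A+B≤N (ι-mono-≤ (ℕ.n≤1+n N))))))

sin-neg : ∀ a n → sin (λ n → - a n) n ≡ - sin a n
sin-neg a n = trans (sin≡sinSum (λ n → - a n) n)
  (trans (sinSum-neg (2 ℕ.* n) (a n)) (cong -_ (sym (sin≡sinSum a n))))

cos-neg : ∀ a n → cos (λ n → - a n) n ≡ cos a n
cos-neg a n = trans (cos≡cosSum (λ n → - a n) n)
  (trans (cosSum-neg (2 ℕ.* n) (a n)) (sym (cos≡cosSum a n)))

-- Boundedness is carried along because `sin-+` asks for it; the pair of properties is closed under
-- integer combinations.
record SinZero (a : Seq) : Set where
  constructor sinZero
  field
    bounded : Bounded a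
    null    : Null (sin a)

SinZero-resp : ∀ {a b} → (∀ n → a n ≡ b n) → SinZero a → SinZero b
SinZero-resp e (sinZero b z) = sinZero (Bounded-resp e b)
  (Null-resp (λ n → cong (λ α → sin (λ _ → α) n) (e n)) z)

SinZero-+ : ∀ {a b} → SinZero a → SinZero b → SinZero λ n → a n + b n
SinZero-+ {a} {b} (sinZero ba za) (sinZero bb zb) = sinZero (Bounded-+ ba bb)
  (Null-resp (λ n → lem (sin a n * cos b n) (cos a n) (sin b n) (sin (λ n → a n + b n) n))
    (Null-- (Null-+ (Null-*-Bounded za (cos-Bounded bb)) (Null-*-Bounded zb (cos-Bounded ba))) (sin-+ ba bb)))
  where
  lem : ∀ p c s e → p + s * c - (p + c * s - e) ≡ e
  lem = solve-∀ ℚ-ring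

SinZero-neg : ∀ {a} → SinZero a → SinZero λ n → - a n
SinZero-neg {a} (sinZero b z) = sinZero (Bounded-neg b) (Null-resp (λ n → sym (sin-neg a n)) (Null-neg z))

SinZero-multiple : ∀ i {a} → SinZero a → SinZero λ n → (i / 1) * a n
SinZero-multiple (+ n) {a} z = go n
  where
  lem : ∀ i a → a + i * a ≡ (1ℚ + i) * a
  lem = solve-∀ ℚ-ring
  go : ∀ n → SinZero λ k → ι n * a k
  go zero    = SinZero-resp (λ k → trans (+-inverseʳ (a k)) (sym (*-zeroˡ (a k)))) (SinZero-+ z (SinZero-neg z))
  go (suc n) = SinZero-resp (λ k → trans (lem (ι n) (a k)) (cong (_* a k) (sym (ι-suc n)))) (SinZero-+ z (go n))
SinZero-multiple ℤ.-[1+ n ] {a} z =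
  SinZero-resp (λ k → neg-distribˡ-* (ι (suc n)) (a k)) (SinZero-neg (SinZero-multiple (+ suc n) z))

-- Parallel vectors have angles differing by a zero of the sine.

1≤∣i/1∣ : ∀ i → i ≢ 0ℤ → 1ℚ ≤ ∣ i / 1 ∣
1≤∣i/1∣ (+ zero)    i≢0 = ⊥-elim (i≢0 refl)
1≤∣i/1∣ (+ suc n)   _   = ≤-trans (ι-mono-≤ {1} {suc n} (s≤s z≤n)) (p≤∣p∣ (ι (suc n)))
1≤∣i/1∣ ℤ.-[1+ n ]  _   = ≤-trans (1≤∣i/1∣ (+ suc n) (λ ())) (≤-reflexive (sym (∣-p∣≡∣p∣ (ι (suc n)))))

-- A nonzero integer gives |i a| ≥ |a|, and i a = (i - r t) a + (r a) t tends to 0. The radius r is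
-- thus removed without dividing by it.
Null-cancel : ∀ {i a r t} → i ≢ 0ℤ → fromℤ i D.≃ (r D.* t) → Bounded t → Bounded a →
              Null (λ n → r n * a n) → Null a
Null-cancel {i} {a} {r} {t} i≢0 e bt ba null = Null-dominated
  (Null-resp (λ n → lem (i / 1) (r n) (t n) (a n)) (Null-+ (Null-*-Bounded e ba) (Null-*-Bounded null bt)))
  λ n → subst₂ _≤_ (*-identityˡ ∣ a n ∣) (sym (∣p*q∣≡∣p∣*∣q∣ (i / 1) (a n)))
    (*-monoʳ-≤-nonNeg ∣ a n ∣ {{∣-∣-nonNeg (a n)}} (1≤∣i/1∣ i i≢0))
  where
  lem : ∀ i r t a → (i - r * t) * a + r * a * t ≡ i * a
  lem = solve-∀ ℚ-ring

nonzero-coordinate : ∀ u → u ≢ 𝟎 → proj₁ u ≢ 0ℤ ⊎ proj₂ u ≢ 0ℤ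
nonzero-coordinate (u₁ , u₂) u≢𝟎 with u₁ ℤ.≟ 0ℤ | u₂ ℤ.≟ 0ℤ
... | yes refl | yes refl = ⊥-elim (u≢𝟎 refl)
... | no u₁≢0  | _        = inj₁ u₁≢0
... | yes _    | no u₂≢0  = inj₂ u₂≢0

-- For u = r(cos θ, sin θ) and v = r′(cos φ, sin φ), in the limit r r′ sin(θ - φ) = u₂v₁ - u₁v₂ = 0.
-- A nonzero coordinate of each vector then cancels its radius.
parallel⇒SinZero : ∀ u v (θ φ : Real) → u ≢ 𝟎 → v ≢ 𝟎 → det u v ≡ 0ℤ →
                   DirHasAngle u θ → DirHasAngle v φ → SinZero (seq θ D.- seq φ)
parallel⇒SinZero u@(u₁ , u₂) v@(v₁ , v₂) θ φ u≢𝟎 v≢𝟎 det≡0 (ρ , u₁≃ , u₂≃) (σ , v₁≃ , v₂≃) =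
  sinZero (Bounded-+ bθ (Bounded-neg bφ))
    (Null-resp (λ n → trans (cong₂ (λ c s′ → w n - (s n * c + cos (seq θ) n * s′ - sin (seq θ D.- seq φ) n))
                                (cos-neg (seq φ) n) (sin-neg (seq φ) n))
                            (lem₁ (s n) (c n) (s′ n) (c′ n) _))
      (Null-- (strip v r′ s′ c′ v₁≃ v₂≃ bs′ bc′ bw v≢𝟎 (strip u r s c u₁≃ u₂≃ bs bc (Bounded-* bσ bw) u≢𝟎 ρσw))
              (sin-+ bθ (Bounded-neg bφ))))
  where
  s c s′ c′ w r r′ : Seq
  s  = sin (seq θ)
  c  = cos (seq θ)
  s′ = sin (seq φ)
  c′ = cos (seq φ)
  w n = s n * c′ n - c n * s′ n
  r  = seq ρ
  r′ = seq σ

  bθ : Bounded (seq θ)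
  bθ = Cauchy⇒Bounded (cauchy θ)
  bφ : Bounded (seq φ)
  bφ = Cauchy⇒Bounded (cauchy φ)
  bσ : Bounded r′
  bσ = Cauchy⇒Bounded (cauchy σ)
  bs : Bounded s
  bs = sin-Bounded bθ
  bc : Bounded c
  bc = cos-Bounded bθ
  bs′ : Bounded s′
  bs′ = sin-Bounded bφ
  bc′ : Bounded c′
  bc′ = cos-Bounded bφ
  bw : Bounded w
  bw = Bounded-+ (Bounded-* bs bc′) (Bounded-neg (Bounded-* bc bs′))

  lem₁ : ∀ s c s′ c′ e → s * c′ - c * s′ - (s * c′ + c * - s′ - e) ≡ e
  lem₁ = solve-∀ ℚ-ring

  strip : ∀ q r s c {a} → fromℤ (proj₁ q) D.≃ (r D.* c) → fromℤ (proj₂ q) D.≃ (r D.* s) →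
          Bounded s → Bounded c → Bounded a → q ≢ 𝟎 → Null (λ n → r n * a n) → Null a
  strip q r s c q₁≃ q₂≃ bs bc ba q≢𝟎 null with nonzero-coordinate q q≢𝟎
  ... | inj₁ q₁≢0 = Null-cancel {r = r} {t = c} q₁≢0 q₁≃ bc ba null
  ... | inj₂ q₂≢0 = Null-cancel {r = r} {t = s} q₂≢0 q₂≃ bs ba null

  det/1 : (u₂ / 1) * (v₁ / 1) ≡ (u₁ / 1) * (v₂ / 1)
  det/1 = trans (sym (/1-* u₂ v₁)) (trans (cong (_/ 1) (sym (ℤ.i-j≡0⇒i≡j (u₁ ℤ.* v₂) (u₂ ℤ.* v₁) det≡0))) (/1-* u₁ v₂))

  ρσw : Null λ n → r n * (r′ n * w n)
  ρσw = Null-resp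
    (λ n → trans (lem₂ (u₁ / 1) (u₂ / 1) (v₁ / 1) (v₂ / 1) (r n) (r′ n) (s n) (c n) (s′ n) (c′ n))
             (trans (cong (λ d → r n * (r′ n * w n) - (d - (u₁ / 1) * (v₂ / 1))) det/1)
                    (lem₃ _ ((u₁ / 1) * (v₂ / 1)))))
    (Null-- (Null-+ (Null-*-Bounded u₁≃ (Bounded-* bσ bs′)) (Null-*-Bounded v₂≃ (Bounded-const (u₁ / 1))))
            (Null-+ (Null-*-Bounded u₂≃ (Bounded-* bσ bc′)) (Null-*-Bounded v₁≃ (Bounded-const (u₂ / 1)))))
    where
    lem₂ : ∀ u₁ u₂ v₁ v₂ r r′ s c s′ c′ →
      ((u₁ - r * c) * (r′ * s′) + (v₂ - r′ * s′) * u₁) - ((u₂ - r * s) * (r′ * c′) + (v₁ - r′ * c′) * u₂) ≡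
      r * (r′ * (s * c′ - c * s′)) - (u₂ * v₁ - u₁ * v₂)
    lem₂ = solve-∀ ℚ-ring
    lem₃ : ∀ p q → p - (q - q) ≡ p
    lem₃ = solve-∀ ℚ-ring

-- The sine is positive on (0, 9/4]

alternating : ℕ → (ℕ → ℚ) → ℚ
alternating n f = sumBelow n λ j → (- 1ℚ) ^ j * f j

alternating-suc : ∀ n f → alternating (suc n) f ≡ f 0 - alternating n (λ j → f (suc j))
alternating-suc n f = trans (sum-first n (λ j → (- 1ℚ) ^ j * f j)) (cong₂ _+_ (*-identityˡ (f 0))
  (trans (sum-cong n λ j _ → lem ((- 1ℚ) ^ j) (f (suc j))) (sum-neg n (λ j → (- 1ℚ) ^ j * f (suc j)))))
  where
  lem : ∀ p q → - 1ℚ * p * q ≡ - (p * q)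
  lem = solve-∀ ℚ-ring

-- Leibniz's criterion: what is subtracted from `f 0` is an alternating sum of the shifted sequence,
-- which by induction lies between 0 and `f 1`.
alternating-bounds : ∀ n f → (∀ j → 0ℚ ≤ f j) → (∀ j → f (suc j) ≤ f j) →
                     0ℚ ≤ alternating n f × alternating n f ≤ f 0
alternating-bounds zero    f nonneg decr = ≤-refl , nonneg 0
alternating-bounds (suc n) f nonneg decr
  with alternating-bounds n (λ j → f (suc j)) (λ j → nonneg (suc j)) (λ j → decr (suc j))
... | 0≤rest , rest≤ =
    subst (0ℚ ≤_) (sym (alternating-suc n f)) (0≤-difference (≤-trans rest≤ (decr 0)))
  , 0≤⇒≤ 0≤rest (trans (lem (f 0) _) (cong (λ s → f 0 - s) (sym (alternating-suc n f))))
  where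
  lem : ∀ p q → q ≡ p - (p - q)
  lem = solve-∀ ℚ-ring

module _ {z : ℚ} (0≤z : 0ℚ ≤ z) (z≤9/4 : z ≤ + 9 / 4) where

  -- The bound is 6 · 7/8, where 6 is the least value of (k + 2)(k + 3), so that successive odd
  -- terms shrink by the factor 7/8. It holds because 81/16 ≤ 84/16.
  z²≤ : z * z ≤ + 21 / 4
  z²≤ = ≤-trans (*-mono-≤-nonNeg 0≤z (≤-trans 0≤z z≤9/4) z≤9/4 z≤9/4)
                (from-yes ((+ 9 / 4) * (+ 9 / 4) ≤? + 21 / 4))

  expTerm-decrease : ∀ k → expTerm (3 ℕ.+ k) z ≤ (+ 7 / 8) * expTerm (1 ℕ.+ k) z
  expTerm-decrease k = *-cancelˡ-≤-0< {ι 6} (from-yes (0ℚ <? ι 6)) (begin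
    ι 6 * t₃                        ≤⟨ *-monoʳ-≤-nonNeg t₃ {{nonNegative (0≤expTerm (3 ℕ.+ k) 0≤z)}} six ⟩
    ι (2 ℕ.+ k) * ι (3 ℕ.+ k) * t₃  ≡⟨ *-assoc (ι (2 ℕ.+ k)) (ι (3 ℕ.+ k)) t₃ ⟩
    ι (2 ℕ.+ k) * (ι (3 ℕ.+ k) * t₃) ≡⟨ cong (ι (2 ℕ.+ k) *_) (expTerm-suc (2 ℕ.+ k) z) ⟩
    ι (2 ℕ.+ k) * (z * t₂)          ≡⟨ lem₁ (ι (2 ℕ.+ k)) z t₂ ⟩
    z * (ι (2 ℕ.+ k) * t₂)          ≡⟨ cong (z *_) (expTerm-suc (1 ℕ.+ k) z) ⟩
    z * (z * t₁)                    ≡⟨ sym (*-assoc z z t₁) ⟩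
    z * z * t₁                      ≤⟨ *-monoʳ-≤-nonNeg t₁ {{nonNegative (0≤expTerm (1 ℕ.+ k) 0≤z)}} z²≤ ⟩
    (+ 21 / 4) * t₁                 ≡⟨ *-assoc (ι 6) (+ 7 / 8) t₁ ⟩
    ι 6 * ((+ 7 / 8) * t₁)          ∎)
    where
    open ≤-Reasoning
    t₁ t₂ t₃ : ℚ
    t₁ = expTerm (1 ℕ.+ k) z
    t₂ = expTerm (2 ℕ.+ k) z
    t₃ = expTerm (3 ℕ.+ k) z
    lem₁ : ∀ i z t → i * (z * t) ≡ z * (i * t)
    lem₁ = solve-∀ ℚ-ring
    six : ι 6 ≤ ι (2 ℕ.+ k) * ι (3 ℕ.+ k)
    six = *-mono-≤-nonNeg {ι 2} {ι (2 ℕ.+ k)} {ι 3} {ι (3 ℕ.+ k)} (0≤ι 2) (0≤ι (3 ℕ.+ k))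
      (ι-mono-≤ (ℕ.m≤m+n 2 k)) (ι-mono-≤ (ℕ.m≤m+n 3 k))

  oddTerm : ℕ → ℚ
  oddTerm j = expTerm (suc (2 ℕ.* j)) z

  oddTerm-suc≤ : ∀ j → oddTerm (suc j) ≤ (+ 7 / 8) * oddTerm j
  oddTerm-suc≤ j = subst
    (λ k → expTerm (suc k) z ≤ (+ 7 / 8) * oddTerm j) (sym (ℕ.*-suc 2 j)) (expTerm-decrease (2 ℕ.* j))

  0≤oddTerm : ∀ j → 0ℚ ≤ oddTerm j
  0≤oddTerm j = 0≤expTerm (suc (2 ℕ.* j)) 0≤z

  oddTerm-decreasing : ∀ j → oddTerm (suc j) ≤ oddTerm j
  oddTerm-decreasing j = ≤-trans (oddTerm-suc≤ j)
    (0≤⇒≤ (0≤-* (from-yes (0ℚ ≤? + 1 / 8)) (0≤oddTerm j)) (lem (oddTerm j)))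
    where
    lem : ∀ t → (+ 1 / 8) * t ≡ t - (+ 7 / 8) * t
    lem = solve-∀ ℚ-ring

  -- After the first term z, the alternating rest is at most its own first term, hence at most 7z/8.
  -- The index is a successor because the empty sum lacks the term z.
  sin-lower-bound : ∀ n → (+ 1 / 8) * z ≤ sin (λ _ → z) (suc n)
  sin-lower-bound n = begin
    (+ 1 / 8) * z                                       ≡⟨ lem z ⟩
    oddTerm 0 - (+ 7 / 8) * oddTerm 0                   ≤⟨ +-monoʳ-≤ (oddTerm 0) (neg-antimono-≤ (≤-trans
      (proj₂ (alternating-bounds n (λ j → oddTerm (suc j)) (λ j → 0≤oddTerm (suc j)) (λ j → oddTerm-decreasing (suc j))))
      (oddTerm-suc≤ 0))) ⟩
    oddTerm 0 - alternating n (λ j → oddTerm (suc j))   ≡⟨ sym (alternating-suc n oddTerm) ⟩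
    alternating (suc n) oddTerm                         ≡⟨ sum-cong (suc n) (λ j _ → sym (*-assoc ((- 1ℚ) ^ j) _ _)) ⟩
    sin (λ _ → z) (suc n)                               ∎
    where
    open ≤-Reasoning
    lem : ∀ z → (+ 1 / 8) * z ≡ z * 1ℚ * 1ℚ - (+ 7 / 8) * (z * 1ℚ * 1ℚ)
    lem = solve-∀ ℚ-ring

-- A zero y of the sine that is at most as far from 0 as from ±π satisfies |y| ≤ π/2 ≤ 2, so it is 0.

nearest-zero : ∀ {ε η δ d y π} →
  0ℚ < ε → ι 4 * ε ≤ η → ε ≤ + 1 / 8 → η ≤ δ → δ ≤ d + ε → ∣ d - ∣ y ∣ ∣ ≤ ε →
  d ≤ ∣ y - π ∣ + ε → d ≤ ∣ y + π ∣ + ε → ι 3 ≤ π + ε → π ≤ ι 4 + ε →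
  (ι 2 * ε ≤ ∣ y ∣) × (∣ y ∣ ≤ + 9 / 4)
nearest-zero {ε} {η} {δ} {d} {y} {π} 0<ε 4ε≤η ε≤⅛ η≤δ δ≤d+ε close d≤₋ d≤₊ 3≤π π≤4 = lower , upper
  where
  z : ℚ
  z = ∣ y ∣

  d≤z+ε : d ≤ z + ε
  d≤z+ε = 0≤⇒≤ (0≤-difference (≤-trans (p≤∣p∣ (d - z)) close)) (lem d z ε)
    where
    lem : ∀ d z ε → ε - (d - z) ≡ z + ε - d
    lem = solve-∀ ℚ-ring

  z≤d+ε : z ≤ d + ε
  z≤d+ε = 0≤⇒≤ (0≤-difference (≤-trans (-p≤∣p∣ (d - z)) close)) (lem d z ε)
    where
    lem : ∀ d z ε → ε - - (d - z) ≡ d + ε - z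
    lem = solve-∀ ℚ-ring

  lower : ι 2 * ε ≤ z
  lower = 0≤⇒≤
    (0≤-+ (0≤-difference 4ε≤η) (0≤-+ (0≤-difference η≤δ) (0≤-+ (0≤-difference δ≤d+ε) (0≤-difference d≤z+ε))))
    (lem ε η δ d z)
    where
    lem : ∀ ε η δ d z → η - (+ 4 / 1) * ε + (δ - η + (d + ε - δ + (z + ε - d))) ≡ z - (+ 2 / 1) * ε
    lem = solve-∀ ℚ-ring

  d≤∣z-π∣+ε : d ≤ ∣ z - π ∣ + ε
  d≤∣z-π∣+ε with ∣p∣≡p∨∣p∣≡-p y
  ... | inj₁ e = subst (λ z → d ≤ ∣ z - π ∣ + ε) (sym e) d≤₋
  ... | inj₂ e = subst (λ q → d ≤ q + ε)
    (trans (sym (∣-p∣≡∣p∣ (y + π))) (cong ∣_∣ (trans (neg-distrib-+ y π) (cong (_- π) (sym e))))) d≤₊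

  -- For z ≤ π, the bounds z ≤ d + ε and d ≤ π - z + ε give 2z ≤ π + 2ε ≤ 4 + 3ε ≤ 4 + 3/8, and 9/4
  -- exceeds half of this.
  upper : z ≤ + 9 / 4
  upper with ≤-total z π
  ... | inj₁ z≤π = *-cancelˡ-≤-0< {ι 2} (from-yes (0ℚ <? ι 2)) (0≤⇒≤
    (0≤-+ (0≤-difference z≤d+ε) (0≤-+ (0≤-difference (subst (λ q → d ≤ q + ε) flip d≤∣z-π∣+ε))
      (0≤-+ (0≤-difference π≤4) (0≤-+ (0≤-* (from-yes (0ℚ ≤? ι 3)) (0≤-difference ε≤⅛))
                                            (from-yes (0ℚ ≤? + 1 / 8))))))
    (lem z d ε π))
    where
    flip : ∣ z - π ∣ ≡ π - z
    flip = trans (sym (∣-p∣≡∣p∣ (z - π))) (trans (cong ∣_∣ (lem z π)) (0≤p⇒∣p∣≡p (0≤-difference z≤π)))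
      where
      lem : ∀ z π → - (z - π) ≡ π - z
      lem = solve-∀ ℚ-ring
    lem : ∀ z d ε π → d + ε - z + (π - z + ε - d + ((+ 4 / 1) + ε - π + ((+ 3 / 1) * ((+ 1 / 8) - ε) + (+ 1 / 8)))) ≡
          (+ 2 / 1) * (+ 9 / 4) - (+ 2 / 1) * z
    lem = solve-∀ ℚ-ring
  -- Here z ≤ d + ε and d ≤ z - π + ε would give π ≤ 2ε, against 3 ≤ π + ε.
  ... | inj₂ π≤z = ⊥-elim (3≰3/8 (0≤⇒≤
    (0≤-+ (0≤-difference z≤d+ε) (0≤-+ (0≤-difference
             (subst (λ q → d ≤ q + ε) (0≤p⇒∣p∣≡p (0≤-difference π≤z)) d≤∣z-π∣+ε))
      (0≤-+ (0≤-difference 3≤π) (0≤-* (from-yes (0ℚ ≤? ι 3)) (0≤-difference ε≤⅛)))))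
    (lem z d ε π)))
    where
    lem : ∀ z d ε π → d + ε - z + (z - π + ε - d + (π + ε - (+ 3 / 1) + (+ 3 / 1) * ((+ 1 / 8) - ε))) ≡
          (+ 3 / 8) - (+ 3 / 1)
    lem = solve-∀ ℚ-ring
    3≰3/8 : ¬ (ι 3 ≤ + 3 / 8)
    3≰3/8 = from-no (ι 3 ≤? + 3 / 8)

-- The factor 4 leaves |y| ≥ η - 2ε ≥ 2ε after two approximations; the bound 1/8 keeps |y| below
-- 9/4.
smaller-ε : ∀ η → 0ℚ < η → ∃[ ε ] 0ℚ < ε × ι 4 * ε ≤ η × ε ≤ + 1 / 8
smaller-ε η 0<η with ≤-total η ½
... | inj₁ η≤½ = (+ 1 / 4) * η , 0<-* (from-yes (0ℚ <? + 1 / 4)) 0<η , ≤-reflexive (lem η) ,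
  *-monoˡ-≤-nonNeg (+ 1 / 4) η≤½
  where
  lem : ∀ η → (+ 4 / 1) * ((+ 1 / 4) * η) ≡ η
  lem = solve-∀ ℚ-ring
... | inj₂ ½≤η = + 1 / 8 , from-yes (0ℚ <? + 1 / 8) , ½≤η , ≤-refl

∣sin-abs∣ : ∀ a n → ∣ sin (λ n → ∣ a n ∣) n ∣ ≡ ∣ sin a n ∣
∣sin-abs∣ a n with ∣p∣≡p∨∣p∣≡-p (a n)
... | inj₁ e = cong (λ α → ∣ sin (λ _ → α) n ∣) e
... | inj₂ e = trans (cong (λ α → ∣ sin (λ _ → α) n ∣) e) (trans (cong ∣_∣ (sin-neg a n)) (∣-p∣≡∣p∣ (sin a n)))

-- By oddness |y| may replace y, and |y|/8 ≥ 2ε/8 exceeds ε/8.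
sin-large : ∀ y n {ε} → 0ℚ < ε → ι 2 * ε ≤ ∣ y (suc n) ∣ → ∣ y (suc n) ∣ ≤ + 9 / 4 →
            ¬ (∣ sin y (suc n) ∣ ≤ (+ 1 / 8) * ε)
sin-large y n {ε} 0<ε 2ε≤z z≤9/4 small =
  <-irrefl refl (<-≤-trans 0<ε (0≤⇒≤ (0≤-* (from-yes (0ℚ ≤? ι 8)) (0≤-difference 2ε/8≤ε/8)) (lem ε)))
  where
  lem : ∀ ε → (+ 8 / 1) * ((+ 1 / 8) * ε - (+ 1 / 8) * ((+ 2 / 1) * ε)) ≡ 0ℚ - ε
  lem = solve-∀ ℚ-ring
  2ε/8≤ε/8 : (+ 1 / 8) * (ι 2 * ε) ≤ (+ 1 / 8) * ε
  2ε/8≤ε/8 = begin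
    (+ 1 / 8) * (ι 2 * ε)           ≤⟨ *-monoˡ-≤-nonNeg (+ 1 / 8) 2ε≤z ⟩
    (+ 1 / 8) * ∣ y (suc n) ∣       ≤⟨ sin-lower-bound (0≤∣p∣ (y (suc n))) z≤9/4 n ⟩
    sin (abs y) (suc n)             ≤⟨ p≤∣p∣ (sin (abs y) (suc n)) ⟩
    ∣ sin (abs y) (suc n) ∣         ≡⟨ ∣sin-abs∣ y (suc n) ⟩
    ∣ sin y (suc n) ∣               ≤⟨ small ⟩
    (+ 1 / 8) * ε                   ∎
    where open ≤-Reasoning

¬nearest-nonzero : ∀ {δ d y π : Seq} → SinZero y → fromℤ 0ℤ D.< δ → δ D.≤ d → d D.≃ abs y →
  d D.≤ abs (y D.- π) → d D.≤ abs (λ n → y n + π n) → fromℤ (+ 3) D.≤ π → π D.≤ fromℤ (+ 4) → ⊥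
¬nearest-nonzero {δ} {d} {y} {π} zero-y (η , 0<η , K , η≤δ) δ≤d close d≤₋ d≤₊ 3≤π π≤4 =
  -- A successor index is taken since at index 0 the sine is an empty sum.
  proj₂ impossible (suc (proj₁ impossible)) (ℕ.n≤1+n _) λ ()
  where
  ε : ℚ
  ε = proj₁ (smaller-ε η 0<η)
  0<ε : 0ℚ < ε
  0<ε = proj₁ (proj₂ (smaller-ε η 0<η))
  4ε≤η : ι 4 * ε ≤ η
  4ε≤η = proj₁ (proj₂ (proj₂ (smaller-ε η 0<η)))
  ε≤⅛ : ε ≤ + 1 / 8
  ε≤⅛ = proj₂ (proj₂ (proj₂ (smaller-ε η 0<η)))

  range : Eventually λ n → (ι 2 * ε ≤ ∣ y n ∣) × (∣ y n ∣ ≤ + 9 / 4)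
  range = Eventually-map
    (λ n (h₁ , h₂ , h₃ , h₄ , h₅ , h₆ , h₇) → nearest-zero {ε} {η} {δ n} {d n} {y n} {π n} 0<ε 4ε≤η ε≤⅛
      (subst (_≤ δ n) (+-identityˡ η) h₁) h₂ h₃ h₄ h₅ h₆ h₇)
    ((K , η≤δ) & δ≤d ε 0<ε & close ε 0<ε & d≤₋ ε 0<ε & d≤₊ ε 0<ε & 3≤π ε 0<ε & π≤4 ε 0<ε)

  impossible : Eventually λ n → n ≢ 0 → ⊥
  impossible = Eventually-map
    (λ { zero    _              n≢0 → n≢0 refl
       ; (suc n) ((h , h′) , s) _   → sin-large y n 0<ε h h′ s })
    (range & SinZero.null zero-y ((+ 1 / 8) * ε) (0<-* (from-yes (0ℚ <? + 1 / 8)) 0<ε))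

positive-distance⇒independent : ∀ u v (δ d : Real) → u ≢ 𝟎 → v ≢ 𝟎 → fromℤ 0ℤ D.< seq δ →
  IsDirDistance u v d → seq δ D.≤ seq d → LinearlyIndependent u v
positive-distance⇒independent u v δ d u≢𝟎 v≢𝟎 0<δ
  (π , θ , φ , (3≤π , π≤4 , sinπ≃0) , angleᵤ , angleᵥ , (m , d≃) , d≤) δ≤d =
  det≢0⇒LinearlyIndependent u v λ det≡0 →
    ¬nearest-nonzero {seq δ} {seq d} {y} {seq π}
      (SinZero-+ (parallel⇒SinZero u v θ φ u≢𝟎 v≢𝟎 det≡0 angleᵤ angleᵥ) (SinZero-neg (SinZero-multiple m π-zero)))
      0<δ δ≤d d≃ below above 3≤π π≤4
  where
  y : Seq
  y n = seq θ n - seq φ n - (m / 1) * seq π n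

  π-zero : SinZero (seq π)
  π-zero = sinZero (Cauchy⇒Bounded (cauchy π)) (Null-resp (λ n → lem (sin (seq π) n)) sinπ≃0)
    where
    lem : ∀ s → s - 0ℚ ≡ s
    lem = solve-∀ ℚ-ring

  -- Moving the minimizing integer by i moves `y` by iπ; the cases i = 1 and i = -1 are used.
  shift : ∀ i n → seq θ n - seq φ n - ((m ℤ.+ i) / 1) * seq π n ≡ y n - (i / 1) * seq π n
  shift i n = trans (cong (λ q → seq θ n - seq φ n - q * seq π n) (/1-+ m i))
                    (lem (seq θ n - seq φ n) (m / 1) (i / 1) (seq π n))
    where
    lem : ∀ a m i π → a - (m + i) * π ≡ a - m * π - i * π
    lem = solve-∀ ℚ-ring

  below : seq d D.≤ abs (y D.- seq π)
  below ε 0<ε = Eventually-map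
    (λ n → subst (λ q → seq d n ≤ ∣ q ∣ + ε) (trans (shift 1ℤ n) (lem (y n) (seq π n))))
    (d≤ (m ℤ.+ 1ℤ) ε 0<ε)
    where
    lem : ∀ y π → y - 1ℚ * π ≡ y - π
    lem = solve-∀ ℚ-ring

  above : seq d D.≤ abs (λ n → y n + seq π n)
  above ε 0<ε = Eventually-map
    (λ n → subst (λ q → seq d n ≤ ∣ q ∣ + ε) (trans (shift ℤ.-1ℤ n) (lem (y n) (seq π n))))
    (d≤ (m ℤ.+ ℤ.-1ℤ) ε 0<ε)
    where
    lem : ∀ y π → y - (- 1ℚ) * π ≡ y + π
    lem = solve-∀ ℚ-ring

-- Staircases

other-letter : ∀ {a b c : Fin 2} → a ≢ b → c ≢ a → c ≡ b
other-letter {zero}     {zero}     a≢b c≢a = ⊥-elim (a≢b refl)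
other-letter {zero}     {suc zero} {zero}     a≢b c≢a = ⊥-elim (c≢a refl)
other-letter {zero}     {suc zero} {suc zero} a≢b c≢a = refl
other-letter {suc zero} {zero}     {zero}     a≢b c≢a = refl
other-letter {suc zero} {zero}     {suc zero} a≢b c≢a = ⊥-elim (c≢a refl)
other-letter {suc zero} {suc zero} a≢b c≢a = ⊥-elim (a≢b refl)

module Patterns (em : ExcludedMiddle 0ℓ) (x : Config) where

  count : Fin 2 → ℤ² → List ℤ² → ℕ
  count c t S = occurrences c (factor x t S)

  count-accept : ∀ {c} t s S → x (t ⊕ s) ≡ c → count c t (s ∷ S) ≡ suc (count c t S)
  count-accept {c} t s S e = cong length (filter-accept (Fin._≟ c) e)

  count-reject : ∀ {c} t s S → x (t ⊕ s) ≢ c → count c t (s ∷ S) ≡ count c t S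
  count-reject {c} t s S e = cong length (filter-reject (Fin._≟ c) e)

  count-none : ∀ {c} t {S} → All (λ s → x (t ⊕ s) ≢ c) S → count c t S ≡ 0
  count-none t []                     = refl
  count-none t {s ∷ S} (miss ∷ misses) = trans (count-reject t s S miss) (count-none t misses)

  count≡0⇒none : ∀ {c} t S → count c t S ≡ 0 → All (λ s → x (t ⊕ s) ≢ c) S
  count≡0⇒none     t []      _ = []
  count≡0⇒none {c} t (s ∷ S) e = miss ∷ count≡0⇒none t S (trans (sym (count-reject t s S miss)) e)
    where
    miss : x (t ⊕ s) ≢ c
    miss hit = ℕ.1+n≢0 (trans (sym (count-accept t s S hit)) e)

  AllCounts : ℕ → Set
  AllCounts k = ∃[ c ] Σ[ S ∈ List ℤ² ] Unique S × length S ≡ k ×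
                (∀ i → i ≤ℕ k → ∃[ t ] count c t S ≡ i)

  RecurrentOn : List ℤ² → Pred ℤ² 0ℓ
  RecurrentOn F u = ∀ {z} → z ∈ₗ F → x (z ⊕ u) ≡ x z

  -- After the step s the points of F sit at F + s, where u has to recur. The list `T` leaves room
  -- for further points that the same u must respect.
  RecurrentOn-⊕ : ∀ T {F s u} → s ∈ RecurrentOn F → u ∈ RecurrentOn (map (_⊕ s) (T ++ F)) →
                  s ⊕ u ∈ RecurrentOn F
  RecurrentOn-⊕ T {s = s} {u} recₛ recᵤ {z} z∈F =
    trans (cong x (sym (⊕-assoc z s u)))
          (trans (recᵤ (∈-map⁺ (_⊕ s) (∈-++⁺ʳ T z∈F))) (recₛ z∈F))

  Family : Set₁
  Family = Pred (ℤ² × ℤ²) 0ℓ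

  -- The set `F` constrains only `u`; the point `p` may lie anywhere.
  Large : Family → Set
  Large L = ∀ F → ∃[ p ] ∃[ u ] u ∈ RecurrentOn F × (p , u) ∈ L

  -- If the part outside `P` fails at some F, then for every G a member recurrent on F and G
  -- together must lie in `P`.
  Large-split : ∀ {L} (P : Family) → Large L → Large (L ∩ P) ⊎ Large (L ∩ ∁ P)
  Large-split {L} P large with em {Large (L ∩ P)}
  ... | yes yep = inj₁ yep
  ... | no nope = inj₂ outside
    where
    outside : Large (L ∩ ∁ P)
    outside F with em {∃[ p ] ∃[ u ] u ∈ RecurrentOn F × (p , u) ∈ L ∩ ∁ P}
    ... | yes found = found
    ... | no none = ⊥-elim (nope inside)
      where
      inside : Large (L ∩ P)
      inside G with large (F ++ G)
      ... | p , u , rec , l with em {(p , u) ∈ P}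
      ...   | yes q = p , u , (λ z∈G → rec (∈-++⁺ʳ F z∈G)) , l , q
      ...   | no ¬q = ⊥-elim (none (p , u , (λ z∈F → rec (∈-++⁺ˡ z∈F)) , l , ¬q))

  -- All points of `T` carry the letter `c`, so a displacement recurrent on `T` raises every count
  -- at once.
  record Ladder (c : Fin 2) (S T : List ℤ²) : Set where
    field
      unique : Unique S
      base   : ∀ {t} → t ∈ₗ T → x t ≡ c
      counts : ∀ i → i ≤ℕ length S → ∃[ t ] t ∈ₗ T × count c t S ≡ i

  open Ladder

  Ladder-[] : ∀ {c t} → x t ≡ c → Ladder c [] (t ∷ [])
  Ladder-[] e .unique = []
  Ladder-[] e .base (here refl) = e
  Ladder-[] e .counts zero    _  = _ , here refl , refl

  -- The new point supplies the count 0, and `v` adds one to each old count. An old point of count 0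
  -- distinguishes `v` from the elements of `S`.
  Ladder-∷ : ∀ {c S T v t} → Ladder c S T → v ∈ RecurrentOn T → x t ≡ c →
             All (λ s → x (t ⊕ s) ≢ c) (v ∷ S) → Ladder c (v ∷ S) (t ∷ T)
  Ladder-∷ {c} {S} {T} {v} {t} l rec e none = record
    { unique = fresh (l .counts 0 z≤n) ∷ l .unique
    ; base   = λ { (here refl) → e ; (there t∈T) → l .base t∈T }
    ; counts = λ { zero    _       → t , here refl , count-none t none
                 ; (suc i) (s≤s h) → raise (l .counts i h) }
    }
    where
    hit : ∀ {t} → t ∈ₗ T → x (t ⊕ v) ≡ c
    hit t∈T = trans (rec t∈T) (l .base t∈T)

    fresh : ∃[ t ] t ∈ₗ T × count c t S ≡ 0 → All (v ≢_) S
    fresh (t , t∈T , z) = All.map (λ miss v≡s → miss (subst (λ s → x (t ⊕ s) ≡ c) v≡s (hit t∈T)))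
                                  (count≡0⇒none t S z)

    raise : ∀ {i t} → ∃[ t ] t ∈ₗ T × count c t S ≡ i →
            ∃[ t′ ] t′ ∈ₗ (t ∷ T) × count c t′ (v ∷ S) ≡ suc i
    raise (t , t∈T , n) = t , there t∈T , trans (count-accept t v S (hit t∈T)) (cong suc n)

  Ladder⇒AllCounts : ∀ {c S T} → Ladder c S T → AllCounts (length S)
  Ladder⇒AllCounts l = _ , _ , l .unique , refl ,
    λ i h → let (t , _ , n) = l .counts i h in t , n

  -- The Ramsey search for a staircase

  module Search (k : ℕ) {a b : Fin 2} (a≢b : a ≢ b) where

    Flip : Family
    Flip (p , u) = x p ≡ a × x (p ⊕ u) ≡ b

    MissesAt MissesAfter Neutral : ℤ² → Family
    MissesAt    v (p , u) = x (p ⊕ v) ≢ a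
    MissesAfter v (p , u) = x (p ⊕ u ⊕ v) ≢ b
    Neutral     v (p , u) = x (p ⊕ v) ≡ a × x (p ⊕ u ⊕ v) ≡ b

    -- The list `S` holds the sums so far, newest first, with `s` the current one. The count 0 is
    -- left open: by neutrality it occurs at the point of any member of `L`.
    record Run (L : Family) (s : ℤ²) (S T : List ℤ²) : Set where
      field
        large   : Large L
        flip    : L ⊆ Flip
        neutral : All (λ v → L ⊆ Neutral v) (s ∷ S)
        unique  : Unique S
        last    : ∀ {t} → t ∈ₗ T → x (t ⊕ s) ≡ b
        counts  : ∀ i → i ≤ℕ length S → i ≢ 0 → ∃[ t ] t ∈ₗ T × count b t S ≡ i

    -- A failure of neutrality that is uniform on a large subfamily; recurrence on `F` is what a
    -- ladder with points in `F` needs for its next displacement.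
    Exit : Family → List ℤ² → Set₁
    Exit L F = ∃[ v ] v ∈ RecurrentOn F × Σ[ L′ ∈ Family ] Large L′ × L′ ⊆ L ×
               (L′ ⊆ MissesAt v ⊎ L′ ⊆ MissesAfter v)

    Run⇒AllCounts : ∀ {L s S T} → Run L s S T → AllCounts (length S)
    Run⇒AllCounts {L} {s} {S} r = b , S , Run.unique r , refl , counts′
      where
      counts′ : ∀ i → i ≤ℕ length S → ∃[ t ] count b t S ≡ i
      counts′ zero _ with Run.large r []
      ... | p , u , _ , l = p , count-none p
        (All.map (λ N e → a≢b (trans (sym (proj₁ (N l))) e)) (All.tail (Run.neutral r)))
      counts′ (suc i) h = let (t , _ , n) = Run.counts r (suc i) h (λ ()) in t , n

    -- The sums s of the successive steps u are collected as long as they are neutral for a large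
    -- subfamily.
    run : ∀ n F {L s S T} → Run L s S T → s ∈ RecurrentOn F → length S ℕ.+ n ≡ k →
          AllCounts k ⊎ Exit L F
    run zero F {S = S} r rec len =
      inj₁ (subst AllCounts (trans (sym (ℕ.+-identityʳ (length S))) len) (Run⇒AllCounts r))
    run (suc n) F {L} {s} {S} {T} r rec len
      -- Recurrence on T + s preserves the letter `b` at the old points; recurrence on F + s makes
      -- the new sum recurrent on F.
      with Run.large r (map (_⊕ s) (T ++ F))
    ... | p , u , recᵤ , l
      with Large-split (MissesAt (s ⊕ u)) (Run.large r)
    ...   | inj₁ large = inj₂ (s ⊕ u , RecurrentOn-⊕ T rec recᵤ , _ , large , proj₁ , inj₁ proj₂)
    ...   | inj₂ large₁
      with Large-split (MissesAfter (s ⊕ u)) large₁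
    ...     | inj₁ large = inj₂ (s ⊕ u , RecurrentOn-⊕ T rec recᵤ , _ , large , (λ q → proj₁ (proj₁ q)) , inj₂ proj₂)
    ...     | inj₂ large with run n F {L′} {s ⊕ u} {s ⊕ u ∷ S} {p ∷ T} next
                                   (RecurrentOn-⊕ T rec recᵤ)
                                   (trans (sym (ℕ.+-suc (length S) n)) len)
      where
      L′ : Family
      L′ = (L ∩ ∁ (MissesAt (s ⊕ u))) ∩ ∁ (MissesAfter (s ⊕ u))

      neutral′ : L′ ⊆ Neutral (s ⊕ u)
      neutral′ {p , w} ((_ , ¬A) , ¬B) =
          other-letter (λ e → a≢b (sym e)) (λ e → ¬A (λ e′ → a≢b (trans (sym e′) e)))
        , other-letter a≢b (λ e → ¬B (λ e′ → a≢b (trans (sym e) e′)))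

      -- Read as p + u + s, this is the value after the jump, which the neutral sum s leaves
      -- unchanged.
      head≡b : x (p ⊕ (s ⊕ u)) ≡ b
      head≡b = trans (cong x (trans (cong (p ⊕_) (⊕-comm s u)) (sym (⊕-assoc p u s))))
                     (proj₂ (All.head (Run.neutral r) l))

      tail≢b : All (λ v → x (p ⊕ v) ≢ b) S
      tail≢b = All.map (λ N e → a≢b (trans (sym (proj₁ (N l))) e)) (All.tail (Run.neutral r))

      last′ : ∀ {t} → t ∈ₗ p ∷ T → x (t ⊕ (s ⊕ u)) ≡ b
      last′ (here refl)     = head≡b
      last′ {t} (there t∈T) = trans (cong x (sym (⊕-assoc t s u)))
        (trans (recᵤ (∈-map⁺ (_⊕ s) (∈-++⁺ˡ t∈T))) (Run.last r t∈T))

      counts′ : ∀ i → i ≤ℕ suc (length S) → i ≢ 0 →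
                ∃[ t ] t ∈ₗ p ∷ T × count b t (s ⊕ u ∷ S) ≡ i
      counts′ zero          _       i≢0 = ⊥-elim (i≢0 refl)
      counts′ (suc zero)    _       _   = p , here refl ,
        trans (count-accept p (s ⊕ u) S head≡b) (cong suc (count-none p tail≢b))
      counts′ (suc (suc i)) (s≤s h) _   =
        let (t , t∈T , n) = Run.counts r (suc i) h (λ ())
        in  t , there t∈T , trans (count-accept t (s ⊕ u) S (last′ (there t∈T))) (cong suc n)

      next : Run L′ (s ⊕ u) (s ⊕ u ∷ S) (p ∷ T)
      next = record
        { large   = large
        ; flip    = λ q → Run.flip r (proj₁ (proj₁ q))
        ; neutral = neutral′ ∷ neutral′ ∷
            All.map (λ N {_} q → N (proj₁ (proj₁ q))) (All.tail (Run.neutral r))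
        ; unique  = All.map (λ miss e → miss (subst (λ v → x (p ⊕ v) ≡ b) e head≡b)) tail≢b
                    ∷ Run.unique r
        ; last    = last′
        ; counts  = counts′
        }
    ...       | inj₁ done = inj₁ done
    ...       | inj₂ (v , recᵥ , L″ , large″ , sub , cases) =
      inj₂ (v , recᵥ , L″ , large″ , (λ q → proj₁ (proj₁ (sub q))) , cases)

    -- The chain starts from the empty sum 𝟎, whose neutrality is `Flip` itself.
    Run-[] : ∀ {L} → Large L → L ⊆ Flip → Run L 𝟎 [] []
    Run-[] large flip = record
      { large   = large
      ; flip    = flip
      ; neutral = (λ {q} l → trans (cong x (⊕-identityʳ _)) (proj₁ (flip l))
                           , trans (cong x (⊕-identityʳ _)) (proj₂ (flip l))) ∷ []
      ; unique  = []
      ; last    = λ ()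
      ; counts  = λ { zero _ 0≢0 → ⊥-elim (0≢0 refl) }
      }

    -- The numbers m and n are the displacements still missing in the two ladders; each exit of
    -- `run` supplies one. The new point, p or p + u, comes from the shrunken family and therefore
    -- misses the letter under all earlier displacements too.
    search : ∀ m n {L S T S′ T′} → Large L → L ⊆ Flip →
             Ladder a S T → All (λ v → L ⊆ MissesAt v) S → length S ℕ.+ m ≡ k →
             Ladder b S′ T′ → All (λ v → L ⊆ MissesAfter v) S′ → length S′ ℕ.+ n ≡ k →
             AllCounts k
    search zero n {S = S} _ _ l _ e _ _ _ =
      subst AllCounts (trans (sym (ℕ.+-identityʳ (length S))) e) (Ladder⇒AllCounts l)
    search (suc m) zero {S′ = S′} _ _ _ _ _ l′ _ e′ =
      subst AllCounts (trans (sym (ℕ.+-identityʳ (length S′))) e′) (Ladder⇒AllCounts l′)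
    search (suc m) (suc n) {L} {S} {T} {S′} {T′} large flip l A e l′ B e′
      with run k (T ++ T′) (Run-[] large flip) (λ _ → cong x (⊕-identityʳ _)) refl
    ... | inj₁ done = done
    ... | inj₂ (v , rec , L″ , large″ , sub , inj₁ miss) with large″ []
    ...   | p , u , _ , q =
      search m (suc n) large″ (λ q → flip (sub q))
        (Ladder-∷ l (λ t∈T → rec (∈-++⁺ˡ t∈T)) (proj₁ (flip (sub q)))
          (miss q ∷ All.map (λ M → M (sub q)) A))
        (miss ∷ All.map (λ M {_} q → M (sub q)) A) (trans (sym (ℕ.+-suc _ m)) e)
        l′ (All.map (λ M {_} q → M (sub q)) B) e′
    search (suc m) (suc n) {L} {S} {T} {S′} {T′} large flip l A e l′ B e′
        | inj₂ (v , rec , L″ , large″ , sub , inj₂ miss) with large″ []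
    ...   | p , u , _ , q =
      search (suc m) n large″ (λ q → flip (sub q))
        l (All.map (λ M {_} q → M (sub q)) A) e
        (Ladder-∷ l′ (λ t∈T → rec (∈-++⁺ʳ T t∈T)) (proj₂ (flip (sub q)))
          (miss q ∷ All.map (λ M → M (sub q)) B))
        (miss ∷ All.map (λ M {_} q → M (sub q)) B) (trans (sym (ℕ.+-suc _ n)) e′)

    Large⇒AllCounts : ∀ {L} → Large L → L ⊆ Flip → AllCounts k
    Large⇒AllCounts large flip with large []
    ... | p , u , _ , q = search k k large flip
      (Ladder-[] (proj₁ (flip q))) [] refl (Ladder-[] (proj₂ (flip q))) [] refl

  nonperiodic⇒AllCounts : (∀ F → ∃[ u ] u ∈ RecurrentOn F × ¬ (u ∈ Per x)) → ∀ k → AllCounts k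
  nonperiodic⇒AllCounts recurrent k
    -- Fixing the letter at p fixes the direction of the jump, as `Flip` requires.
    with Large-split (λ (p , u) → x p ≡ zero) changes
    where
    changes : Large (λ (p , u) → x (p ⊕ u) ≢ x p)
    changes F with recurrent F
    ... | u , rec , ¬per with em {∃[ p ] x (p ⊕ u) ≢ x p}
    ...   | yes (p , e) = p , u , rec , e
    ...   | no none = ⊥-elim (¬per per)
      where
      per : u ∈ Per x
      per t with x (t ⊕ u) Fin.≟ x t
      ... | yes e = e
      ... | no ¬e = ⊥-elim (none (t , ¬e))
  ... | inj₁ large = Search.Large⇒AllCounts k {zero} {suc zero} (λ ()) large
    λ (e , e₀) → e₀ , other-letter (λ ()) (λ e₁ → e (trans e₁ (sym e₀)))
  ... | inj₂ large = Search.Large⇒AllCounts k {suc zero} {zero} (λ ()) large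
    λ (e , ¬e₀) → let e₁ = other-letter (λ ()) ¬e₀ in
      e₁ , other-letter (λ ()) (λ e′ → e (trans e′ (sym e₁)))

-- Counting classes

module _ (Q : Setoid 0ℓ 0ℓ) where
  open Setoid Q using (_≈_; Carrier) renaming (sym to ≈-sym; trans to ≈-trans)

  HasClasses⇒≤ : ∀ {m n} → HasClasses Q n → (f : Carrier → Fin m) →
                 (∀ {s t} → f s ≡ f t → s ≈ t) → n ≤ℕ m
  HasClasses⇒≤ classes f f-inj = Fin.injective⇒≤ {f = λ i → f (to i)} λ e →
    trans (sym (inverseʳ (Setoid.refl Q))) (inverseʳ (f-inj e))
    where open Inverse classes

  lookup-injective : ∀ {xs} → UniqueSetoid.Unique Q xs → ∀ i j → lookup xs i ≈ lookup xs j → i ≡ j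
  lookup-injective (_ ∷ _)  zero    zero    _ = refl
  lookup-injective (≉ ∷ _)  zero    (suc j) e = ⊥-elim (All.lookupWith (λ ¬p p → ¬p (≈-trans e p)) ≉ (∈-lookup j))
    where
    ∈-lookup : ∀ {xs} j → Any (lookup xs j ≈_) xs
    ∈-lookup {_ ∷ _} zero    = here (Setoid.refl Q)
    ∈-lookup {_ ∷ _} (suc j) = there (∈-lookup j)
  lookup-injective (≉ ∷ u)  (suc i) zero    e = sym (lookup-injective (≉ ∷ u) zero (suc i) (≈-sym e))
  lookup-injective (_ ∷ u)  (suc i) (suc j) e = cong suc (lookup-injective u i j e)

  -- Excluded middle decides the equivalence, so repetitions can be deleted from the cover; the
  -- positions in the remaining list number the classes.
  finite-cover⇒HasClasses : ExcludedMiddle 0ℓ → ∀ xs → (∀ t → Any (t ≈_) xs) → ∃[ n ] HasClasses Q n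
  finite-cover⇒HasClasses em xs cover = length ys , record
    { to        = lookup ys
    ; from      = λ t → Any.index (cover′ t)
    ; to-cong   = λ { refl → Setoid.refl Q }
    ; from-cong = λ {s} {t} s≈t → lookup-injective unique _ _
        (≈-trans (≈-sym (Any.lookup-index (cover′ s))) (≈-trans s≈t (Any.lookup-index (cover′ t))))
    ; inverse   = (λ { {t} refl → ≈-sym (Any.lookup-index (cover′ t)) })
                , (λ {i} {t} t≈i → lookup-injective unique _ _
                     (≈-trans (≈-sym (Any.lookup-index (cover′ t))) t≈i))
    }
    where
    Q? : DecSetoid 0ℓ 0ℓ
    Q? = record { isDecEquivalence = record { isEquivalence = Setoid.isEquivalence Q ; _≟_ = λ _ _ → em } }

    ys : List Carrier
    ys = deduplicate (λ _ _ → em) xs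

    unique : UniqueSetoid.Unique Q ys
    unique = UniqueDec.deduplicate-! Q? xs

    cover′ : ∀ t → Any (t ≈_) ys
    cover′ t = Any.deduplicate⁺ (λ _ _ → em) (λ y≈x t≈x → ≈-trans t≈x (≈-sym y≈x)) (cover t)

-- The bound is lowered until it is attained. At 0 it is the supremum even of an empty set.
bounded⇒IsSup : ExcludedMiddle 0ℓ → ∀ {P : Pred ℕ 0ℓ} I → (∀ n → n ∈ P → n ≤ℕ I) →
                ∃[ m ] IsSup P m × m ≤ℕ I
bounded⇒IsSup em zero bound = 0 , (bound , λ _ _ → z≤n) , z≤n
bounded⇒IsSup em {P} (suc I) bound with em {suc I ∈ P}
... | yes I∈P = suc I , (bound , λ b h → h (suc I) I∈P) , ℕ.≤-refl
... | no  I∉P =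
  let m , sup , m≤I = bounded⇒IsSup em I
        (λ n n∈P → ℕ.≤-pred (ℕ.≤∧≢⇒< (bound n n∈P) λ { refl → I∉P n∈P }))
  in  m , sup , ℕ.m≤n⇒m≤1+n m≤I

occurrences-total : ∀ w → occurrences zero w ℕ.+ occurrences (suc zero) w ≡ length w
occurrences-total []             = refl
occurrences-total (zero ∷ w)     = cong suc (occurrences-total w)
occurrences-total (suc zero ∷ w) = trans (ℕ.+-suc (occurrences zero w) _) (cong suc (occurrences-total w))

-- Over two letters, the length and one count fix the other count.
occurrences-determine : ∀ c w w′ → length w ≡ length w′ → occurrences c w ≡ occurrences c w′ →
                        AbelianEquivalent w w′
occurrences-determine zero w w′ len e zero = e
occurrences-determine zero w w′ len e (suc zero) = ℕ.+-cancelˡ-≡ (occurrences zero w) _ _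
  (trans (occurrences-total w) (trans len (trans (sym (occurrences-total w′))
    (cong (λ n → n ℕ.+ occurrences (suc zero) w′) (sym e)))))
occurrences-determine (suc zero) w w′ len e zero = ℕ.+-cancelʳ-≡ (occurrences (suc zero) w) _ _
  (trans (occurrences-total w) (trans len (trans (sym (occurrences-total w′))
    (cong (λ n → occurrences zero w′ ℕ.+ n) (sym e)))))
occurrences-determine (suc zero) w w′ len e (suc zero) = e

module _ (x : Config) where

  length-factor : ∀ t S → length (factor x t S) ≡ length S
  length-factor t = length-map _

  occurrences-≤ : ∀ c t S → occurrences c (factor x t S) ≤ℕ length S
  occurrences-≤ c t S = subst (occurrences c (factor x t S) ≤ℕ_) (length-factor t S)
                              (length-filter (Fin._≟ c) (factor x t S))

  occurrences⇒equivalent : ∀ c S {s t} → occurrences c (factor x s S) ≡ occurrences c (factor x t S) →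
                           AbelianEquivalent (factor x s S) (factor x t S)
  occurrences⇒equivalent c S {s} {t} = occurrences-determine c (factor x s S) (factor x t S)
    (trans (length-factor s S) (sym (length-factor t S)))

  complexity-≤ : ∀ {S n} → AbelianComplexity x S n → n ≤ℕ suc (length S)
  complexity-≤ {S} classes = HasClasses⇒≤ (abelianClasses x S) classes
    (λ t → fromℕ< (s≤s (occurrences-≤ zero t S)))
    (λ {s} {t} e → occurrences⇒equivalent zero S {s} {t} (Fin.fromℕ<-injective _ _ _ _ e))

  all-counts⇒complexity : ∀ c S → (∀ i → i ≤ℕ length S → ∃[ t ] occurrences c (factor x t S) ≡ i) →
                          AbelianComplexity x S (suc (length S))
  all-counts⇒complexity c S counts = record
    { to        = λ i → proj₁ (witness i)
    ; from      = from
    ; to-cong   = λ { refl → λ _ → refl }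
    ; from-cong = λ e → Fin.fromℕ<-cong _ _ (e c) _ _
    ; inverse   = (λ { {t} refl → occurrences⇒equivalent c S {proj₁ (witness (from t))} {t}
                        (trans (proj₂ (witness (from t))) (Fin.toℕ-fromℕ< _)) })
                , (λ {i} {t} e → trans (Fin.fromℕ<-cong _ _ (trans (e c) (proj₂ (witness i))) _ (Fin.toℕ<n i))
                                       (Fin.fromℕ<-toℕ i _))
    }
    where
    witness : (i : Fin (suc (length S))) → ∃[ t ] occurrences c (factor x t S) ≡ toℕ i
    witness i = counts (toℕ i) (ℕ.≤-pred (Fin.toℕ<n i))

    from : ℤ² → Fin (suc (length S))
    from t = fromℕ< (s≤s (occurrences-≤ c t S))

  AllCounts⇒maximal : (em : ExcludedMiddle 0ℓ) → ∀ {k} → Patterns.AllCounts em x k →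
                      MaximalPatternAbelianComplexity x k (suc k)
  AllCounts⇒maximal em (c , S , unique , refl , counts) =
      (λ { n (S′ , _ , len , classes) → subst (λ l → n ≤ℕ suc l) len (complexity-≤ {S′} classes) })
    , (λ b h → h _ (S , unique , refl , all-counts⇒complexity c S counts))

  coset⇒equivalent : ∀ S s t → s ⊖ t ∈ Per x → AbelianEquivalent (factor x s S) (factor x t S)
  coset⇒equivalent S s t per a = cong (occurrences a) (factors S)
    where
    shift : ∀ a s t → t ℤ.+ a ℤ.+ (s ℤ.- t) ≡ s ℤ.+ a
    shift = ℤ.solve-∀

    factors : ∀ S → factor x s S ≡ factor x t S
    factors []      = refl
    factors (v ∷ S) = cong₂ _∷_
      (trans (cong x (sym (cong₂ _,_ (shift (proj₁ v) (proj₁ s) (proj₁ t))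
                                     (shift (proj₂ v) (proj₂ s) (proj₂ t)))))
             (per (t ⊕ v)))
      (factors S)

  -- Positions in one coset have equal factors, so the number of the coset separates the Abelian
  -- classes.
  complexity-≤-index : ∀ {S n I} → PeriodIndex x I → AbelianComplexity x S n → n ≤ℕ I
  complexity-≤-index {S} index classes = HasClasses⇒≤ (abelianClasses x S) classes from λ {s} {t} e →
    coset⇒equivalent S s t (Setoid.trans (cosets x) {s} {to (from s)} {t}
      (Setoid.sym (cosets x) {to (from s)} {s} (inverseˡ refl)) (inverseˡ e))
    where open Inverse index

  -- Periods and the index of the period group

  Per-⊕ : ∀ {p q} → p ∈ Per x → q ∈ Per x → p ⊕ q ∈ Per x
  Per-⊕ {p} {q} per-p per-q t = trans (cong x (sym (⊕-assoc t p q))) (trans (per-q (t ⊕ p)) (per-p t))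

  Per-neg : ∀ {p} → p ∈ Per x → ℤ.-1ℤ · p ∈ Per x
  Per-neg {p₁ , p₂} per (t₁ , t₂) = trans
    (sym (per _)) (cong x (cong₂ _,_ (cancel t₁ p₁) (cancel t₂ p₂)))
    where
    cancel : ∀ t p → t ℤ.+ ℤ.-1ℤ ℤ.* p ℤ.+ p ≡ t
    cancel = ℤ.solve-∀

  Per-·ℕ : ∀ n {p} → p ∈ Per x → (+ n) · p ∈ Per x
  Per-·ℕ zero    {p} per t = cong x (⊕-identityʳ t)
  Per-·ℕ (suc n) {p@(p₁ , p₂)} per =
    subst (Per x) (cong₂ _,_ (sym (ℤ.suc-* (+ n) p₁)) (sym (ℤ.suc-* (+ n) p₂)))
          (Per-⊕ {p} {(+ n) · p} per (Per-·ℕ n {p} per))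

  Per-· : ∀ c {p} → p ∈ Per x → c · p ∈ Per x
  Per-· (+ n)         {p} per = Per-·ℕ n {p} per
  Per-· (ℤ.-[1+ n ]) {p@(p₁ , p₂)} per =
    subst (Per x) (cong₂ _,_ (lem (+ suc n) p₁) (lem (+ suc n) p₂))
          (Per-neg {(+ suc n) · p} (Per-·ℕ (suc n) {p} per))
    where
    lem : ∀ n p → ℤ.-1ℤ ℤ.* (n ℤ.* p) ≡ (ℤ.- n) ℤ.* p
    lem = ℤ.solve-∀

  -- Reducing both coordinates modulo `D` is a translation by a period, so the finitely many pairs
  -- of residues meet every coset.
  axis-periods⇒finite-index : ExcludedMiddle 0ℓ → ∀ D .{{_ : ℤ.NonZero D}} →
    (D , 0ℤ) ∈ Per x → (0ℤ , D) ∈ Per x → ∃[ I ] PeriodIndex x I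
  axis-periods⇒finite-index em D per₁ per₂ =
    finite-cover⇒HasClasses (cosets x) em (cartesianProduct residues residues) λ t →
      Any.map (λ { refl → reduce t })
        (∈-cartesianProduct⁺ (∈-residues (proj₁ t)) (∈-residues (proj₂ t)))
    where
    residues : List ℤ
    residues = map +_ (upTo ℤ.∣ D ∣)

    ∈-residues : ∀ i → + (i ℤ.% D) ∈ₗ residues
    ∈-residues i = ∈-map⁺ +_ (∈-upTo⁺ (ℤ.n%d<d i D))

    quotient : ∀ i → i ℤ.- + (i ℤ.% D) ≡ (i ℤ./ D) ℤ.* D
    quotient i = trans (cong (ℤ._- + (i ℤ.% D)) (ℤ.a≡a%n+[a/n]*n i D)) (lem (+ (i ℤ.% D)) _)
      where
      lem : ∀ r q → r ℤ.+ q ℤ.- r ≡ q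
      lem = ℤ.solve-∀

    reduce : ∀ t → t ⊖ (+ (proj₁ t ℤ.% D) , + (proj₂ t ℤ.% D)) ∈ Per x
    reduce (t₁ , t₂) = subst (Per x)
      (cong₂ _,_ (trans (lem (t₁ ℤ./ D) (t₂ ℤ./ D) D) (sym (quotient t₁)))
                 (trans (lem′ (t₁ ℤ./ D) (t₂ ℤ./ D) D) (sym (quotient t₂))))
      (Per-⊕ {(t₁ ℤ./ D) · (D , 0ℤ)} {(t₂ ℤ./ D) · (0ℤ , D)}
        (Per-· (t₁ ℤ./ D) {D , 0ℤ} per₁) (Per-· (t₂ ℤ./ D) {0ℤ , D} per₂))
      where
      lem : ∀ a b D → a ℤ.* D ℤ.+ b ℤ.* 0ℤ ≡ a ℤ.* D
      lem = ℤ.solve-∀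
      lem′ : ∀ a b D → a ℤ.* 0ℤ ℤ.+ b ℤ.* D ≡ b ℤ.* D
      lem′ = ℤ.solve-∀

  DoublyPeriodic⇒finite-index : ExcludedMiddle 0ℓ → DoublyPeriodic x → ∃[ I ] PeriodIndex x I
  DoublyPeriodic⇒finite-index em (p@(p₁ , p₂) , q@(q₁ , q₂) , per-p , per-q , indep) =
    axis-periods⇒finite-index em (det p q) {{ℤ.≢-nonZero (LinearlyIndependent⇒det≢0 p q indep)}}
      (subst (Per x) (eliminate₁ p q)
        (Per-⊕ {q₂ · p} {(ℤ.- p₂) · q} (Per-· q₂ {p} per-p) (Per-· (ℤ.- p₂) {q} per-q)))
      (subst (Per x) (eliminate₂ p q)
        (Per-⊕ {(ℤ.- q₁) · p} {p₁ · q} (Per-· (ℤ.- q₁) {p} per-p) (Per-· p₁ {q} per-q)))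

-- Strong recurrence and the dichotomy

StronglyRecurrent⇒independent : ∀ {x} → StronglyRecurrent x → ∀ N → 1 ≤ℕ N → ∃[ u ] ∃[ v ]
  LinearlyIndependent u v × (∀ z → z ∈Σ N → (x (z ⊕ u) ≡ x z) × (x z ≡ x (z ⊕ v)))
StronglyRecurrent⇒independent (δ , 0<δ , recurrent) N 1≤N =
  let u , v , u≢𝟎 , v≢𝟎 , agree , d , distance , δ≤d = recurrent N 1≤N
  in  u , v , positive-distance⇒independent u v δ d u≢𝟎 v≢𝟎 0<δ distance δ≤d , agree

StronglyRecurrent⇒nonperiodic : (em : ExcludedMiddle 0ℓ) (x : Config) → StronglyRecurrent x → ¬ DoublyPeriodic x →
  ∀ F → ∃[ u ] u ∈ Patterns.RecurrentOn em x F × ¬ (u ∈ Per x)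
StronglyRecurrent⇒nonperiodic em x recurrent aperiodic F =
  let N , bound = finite⇒bounded F
      -- The box bound of `F` may be 0, whereas recurrence is given only from size 1 on.
      u , v , independent , agree = StronglyRecurrent⇒independent recurrent (suc N) (s≤s z≤n)
      agree-on-F : ∀ {z} → z ∈ₗ F → (x (z ⊕ u) ≡ x z) × (x z ≡ x (z ⊕ v))
      agree-on-F z∈F = agree _ (∈Σ-intro (ℕ.m≤n⇒m≤1+n (proj₁ (bound z∈F))) (ℕ.m≤n⇒m≤1+n (proj₂ (bound z∈F))))
  in  choose u v independent (λ z∈F → proj₁ (agree-on-F z∈F)) (λ z∈F → sym (proj₂ (agree-on-F z∈F)))
  where
  open Patterns em x using (RecurrentOn)
  choose : ∀ u v → LinearlyIndependent u v → u ∈ RecurrentOn F → v ∈ RecurrentOn F →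
           ∃[ w ] w ∈ RecurrentOn F × ¬ (w ∈ Per x)
  choose u v independent recᵤ recᵥ with em {u ∈ Per x} | em {v ∈ Per x}
  ... | no ¬per  | _        = u , recᵤ , ¬per
  ... | yes _    | no ¬per  = v , recᵥ , ¬per
  ... | yes perᵤ | yes perᵥ = ⊥-elim (aperiodic (u , v , perᵤ , perᵥ , independent))

DoublyPeriodic⇒bounded : ExcludedMiddle 0ℓ → ∀ x → DoublyPeriodic x → ∃[ I ] PeriodIndex x I ×
  (∀ k → 1 ≤ℕ k → ∃[ m ] MaximalPatternAbelianComplexity x k m × m ≤ℕ I)
DoublyPeriodic⇒bounded em x periodic =
  let I , index = DoublyPeriodic⇒finite-index x em periodic
  in  I , index , λ k _ → bounded⇒IsSup em I λ n (S , _ , _ , classes) → complexity-≤-index x {S} index classes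

aperiodic⇒maximal : ExcludedMiddle 0ℓ → ∀ x → StronglyRecurrent x → ¬ DoublyPeriodic x →
  ∀ k → 1 ≤ℕ k → MaximalPatternAbelianComplexity x k (suc k)
aperiodic⇒maximal em x recurrent aperiodic k _ = AllCounts⇒maximal x em
  (Patterns.nonperiodic⇒AllCounts em x (StronglyRecurrent⇒nonperiodic em x recurrent aperiodic) k)

decide : ∀ {P A B : Set} → Dec P → (P → A) → (¬ P → B) → (P × A) ⊎ (¬ P × B)
decide (yes p) f g = inj₁ (p , f p)
decide (no ¬p) f g = inj₂ (¬p , g ¬p)

theorem5p7 : ExcludedMiddle 0ℓ → (x : Config) → StronglyRecurrent x →
    let i  = DoublyPeriodic x × (∃[ I ] PeriodIndex x I ×
                 (∀ k → 1 ≤ℕ k → ∃[ m ] MaximalPatternAbelianComplexity x k m × m ≤ℕ I))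
        ii = (¬ DoublyPeriodic x) ×
                 (∀ k → 1 ≤ℕ k → MaximalPatternAbelianComplexity x k (suc k))
    in (i ⊎ ii) × (¬ (i × ii))
theorem5p7 em x recurrent =
    decide em (DoublyPeriodic⇒bounded em x) (aperiodic⇒maximal em x recurrent)
  , λ ((periodic , _) , (aperiodic , _)) → aperiodic periodic
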